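{- Let $q$ be a prime power with $\mathrm{char}\,\mathbb{F}_q\ne 3$ and $q\ge 5$. Let \[ f(X)=aX+\frac{1}{X-r}+\frac{1}{X-r^q}+\frac{1}{X-r^{q^2}}, \] where $a\in\mathbb{F}_q^*$ and $r\in\mathbb{F}_{q^3}\setminus\mathbb{F}_q$. Then $f$ is not a permutation rational function of $\mathbb{P}^1(\mathbb{F}_q)$.
   Context: $\mathbb{P}^1(\mathbb{F}_q)=\mathbb{F}_q\cup\{\infty\}$ is the projective line over $\mathbb{F}_q$. A rational function $f=P/Q\in\mathbb{F}_q(X)$ ($P,Q$ coprime) defines a map $\mathbb{P}^1(\mathbb{F}_q)\to\mathbb{P}^1(\mathbb{F}_q)$ in the usual way (zeros of $Q$ map to $\infty$, and $f(\infty)$ is the limiting value). A permutation rational function of $\mathbb{P}^1(\mathbb{F}_q)$ is a rational function whose induced map on $\mathbb{P}^1(\mathbb{F}_q)$ is a bijection. -}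

module Defs where

open import Level using (0ℓ)
open import Data.Nat as ℕ using (ℕ; zero; suc; _≥_)
open import Data.Nat.Primality using (Prime)
open import Data.Fin using (Fin)
open import Data.Maybe using (Maybe; just; nothing)
open import Data.Product using (Σ; ∃; _×_; _,_)
open import Data.Unit using (⊤)
open import Relation.Binary.PropositionalEquality using (_≡_)
open import Relation.Nullary using (¬_)
open import Function.Bundles using (_↔_)
open import Algebra.Structures using (IsCommutativeRing)

IsPrimePower : ℕ → Set
IsPrimePower q = Σ ℕ λ p → Σ ℕ λ k → Prime p × k ≥ 1 × q ≡ p ℕ.^ k

-- A field (with propositional equality), inverse made total with 0⁻¹ arbitrary.
record Field : Set₁ where
  infixl 7 _*_
  infixl 6 _+_ _-_
  field
    Carrier : Set
    _+_ _*_ : Carrier → Carrier → Carrier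
    -_      : Carrier → Carrier
    0# 1#   : Carrier
    isCommutativeRing : IsCommutativeRing _≡_ _+_ _*_ -_ 0# 1#
    _⁻¹     : Carrier → Carrier
    0≢1     : ¬ (0# ≡ 1#)
    inverseʳ : ∀ x → ¬ (x ≡ 0#) → x * (x ⁻¹) ≡ 1#

  _-_ : Carrier → Carrier → Carrier
  x - y = x + (- y)

  _^_ : Carrier → ℕ → Carrier
  x ^ zero = 1#
  x ^ suc n = x * (x ^ n)

record FiniteField (n : ℕ) : Set₁ where
  field
    field′ : Field
  open Field field′ public
  field
    enumeration : Carrier ↔ Fin n

module _ {n : ℕ} (L : FiniteField n) (q : ℕ) where
  open FiniteField L

  -- F_q ⊆ F_{q^3} = L, realized as the fixed points of x ↦ x^q
  InFq : Carrier → Set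
  InFq x = x ^ q ≡ x

  -- P¹ over L: nothing = ∞; P¹(F_q) is the subset below
  InP1Fq : Maybe Carrier → Set
  InP1Fq nothing  = ⊤
  InP1Fq (just x) = InFq x

  IsPermutationP1 : (Maybe Carrier → Maybe Carrier) → Set
  IsPermutationP1 F =
    (∀ u → InP1Fq u → InP1Fq (F u)) ×
    (∀ u v → InP1Fq u → InP1Fq v → F u ≡ F v → u ≡ v) ×
    (∀ v → InP1Fq v → ∃ λ u → InP1Fq u × F u ≡ v)

  fEval : (a r x : Carrier) → Carrier
  fEval a r x = a * x + (x - r) ⁻¹ + (x - r ^ q) ⁻¹ + (x - r ^ (q ℕ.* q)) ⁻¹

  -- induced map on P¹: f(∞) = ∞ (deg numerator 4 > deg denominator 3);
  -- points of F_q are never poles since r, r^q, r^{q^2} ∉ F_q.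
  fMap : (a r : Carrier) → Maybe Carrier → Maybe Carrier
  fMap a r nothing  = nothing
  fMap a r (just x) = just (fEval a r x)

{-# OPTIONS --safe #-}

-- Let S denote summation over F_q.  The power sums S(x^j) vanish for 0 ≤ j < q - 1 and S(x^(q-1))
-- = -1: if S(x^j) ≠ 0, then x^j = 1 on F_q^*, and for H = (X^(q³) - X)/(X^q - X) the polynomial X
-- (X^j - 1) H vanishes on F_(q³), so its degree 1 + j + q³ - q is at least q³.  For r ∉ F_q and t
-- = r^q - r, the identity t/(x - r) = 1 - (x - r)^(q-1) on F_q then yields Carlitz's formula
-- S(1/(x - r)^k) = 1/t^k for 1 ≤ k ≤ q. If f permutes F_q then S(f) = S(f²) = S(f³) = 0.  Write
-- r₁, r₂, r₃ for the conjugates of r, t₁ = r₂ - r₁ and so on.  S(f) = 0 says ∑ 1/tₖ = 0; together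
-- with ∑ tₖ = 0 it forces t₂ = ω t₁ and t₃ = ω² t₁ with ω² + ω + 1 = 0.  Expanding powers of f by
-- partial fractions, S(f²) = 2a(ω² - 1), and in characteristic 2, S(f³) = ω/t₁³; one of the two is
-- nonzero.
module Submission where

open import Defs
open import Level using (0ℓ)
open import Algebra.Bundles using (CommutativeMonoid; CommutativeRing)
import Algebra.Properties.AbelianGroup
import Algebra.Properties.CommutativeMonoid.Sum
import Algebra.Properties.CommutativeSemiring.Binomial
import Algebra.Properties.Ring
import Algebra.Properties.Semiring.Exp
import Algebra.Properties.Semiring.Mult
import Algebra.Properties.Semiring.Mult.TCOptimised
import Algebra.Properties.Semiring.Sum
import Algebra.Solver.Ring
open import Algebra.Solver.Ring.AlmostCommutativeRing using (fromCommutativeRing; _-Raw-AlmostCommutative⟶_)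
open import Data.Bool.Base using (if_then_else_)
open import Data.Empty using (⊥; ⊥-elim)
open import Data.Fin.Base using (Fin; zero; suc; toℕ; fromℕ; inject₁; punchIn)
open import Data.Fin.Permutation using (permutation)
import Data.Fin.Properties as Fin
open import Data.Maybe.Base using (Maybe; just; nothing)
open import Data.Maybe.Properties using (just-injective)
open import Data.Nat as ℕ using (ℕ; zero; suc; _!; z≤n; s≤s; _≥_)
open import Data.Nat.Combinatorics using (_C_; nCk≡n!/k![n-k]!; nCn≡1; k![n∸k]!∣n!)
open import Data.Nat.DivMod using (m/n*n≡m)
open import Data.Nat.Divisibility using (_∣_; divides; ∣⇒≤; m∣m*n)
open import Data.Nat.Primality using (Prime; euclidsLemma; prime⇒nonZero; prime⇒nonTrivial)
import Data.Nat.Properties as ℕ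
open import Data.Product.Base using (∃; _×_; _,_; proj₁; proj₂)
open import Data.Sum.Base using (inj₁; inj₂; [_,_]′)
open import Function.Base using (_∘_)
open import Function.Bundles using (_↔_; Inverse)
open import Function.Definitions using (Injective)
open import Relation.Binary.Definitions using (DecidableEquality)
open import Relation.Binary.PropositionalEquality using (_≡_; _≢_; refl; sym; trans; cong; cong₂; subst; module ≡-Reasoning)
import Relation.Binary.Reasoning.Setoid
open import Relation.Nullary using (¬_; Dec; does; yes; no)
open import Relation.Nullary.Decidable using (dec-true; dec-false; decidable-stable)

-- Of F_q only the equation x^q = x is available; that it has q elements is never proved. Facts
-- usually read off from that count are reached otherwise: S(1) = 0 by the translation x ↦ x + 1,
-- and the bound j ≥ q - 1 by counting roots in F_(q³), whose size is given. This is why H is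
-- brought in: it takes care of the elements outside F_q. The cube is needed because squaring is
-- additive in characteristic 2, so that S(f²) = S(f)² tells nothing new. S(x³) must then vanish
-- too, that is 3 < q - 1, which q ≥ 5 provides. Characteristic 3 is the case where ω = 1 and 2a(ω²
-- - 1) = 0.

-- Ring solver with integer coefficients

module IntegerCoefficientSolver {c ℓ} (R : CommutativeRing c ℓ) where
  open CommutativeRing R renaming (refl to ≈-refl; sym to ≈-sym; trans to ≈-trans)
  open import Data.Integer.Base as ℤ using (ℤ; +_; -[1+_])
  import Data.Integer.Properties as ℤ
  open Algebra.Properties.Semiring.Mult.TCOptimised semiring
    using (×-homo-+; ×1-homo-*; 1+×) renaming (_×_ to _×′_)
  open Algebra.Properties.Ring ring using (-‿distribˡ-*; -‿distribʳ-*; -0#≈0#; -‿involutive)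
  open Algebra.Properties.AbelianGroup +-abelianGroup using (⁻¹-∙-comm)
  open Relation.Binary.Reasoning.Setoid setoid

  -- Coefficients are compared in ℤ, so identities are normalised over any commutative ring without
  -- deciding its equality. The optimised multiple `1 ×′ 1#` reduces to `1#`, hence `:1` denotes
  -- `1#` definitionally.
  ⟦_⟧ℤ : ℤ → Carrier
  ⟦ + n ⟧ℤ      = n ×′ 1#
  ⟦ -[1+ n ] ⟧ℤ = - (suc n ×′ 1#)

  cancel-1+ : ∀ x y → (1# + x) + - (1# + y) ≈ x + - y
  cancel-1+ x y = begin
    (1# + x) + - (1# + y)     ≈⟨ +-cong (+-comm 1# x) (≈-sym (⁻¹-∙-comm 1# y)) ⟩
    (x + 1#) + (- 1# + - y)   ≈⟨ +-assoc x 1# _ ⟩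
    x + (1# + (- 1# + - y))   ≈⟨ +-congˡ (≈-sym (+-assoc 1# (- 1#) (- y))) ⟩
    x + ((1# + - 1#) + - y)   ≈⟨ +-congˡ (+-congʳ (-‿inverseʳ 1#)) ⟩
    x + (0# + - y)            ≈⟨ +-congˡ (+-identityˡ _) ⟩
    x + - y                   ∎

  ⊖-homo : ∀ m n → ⟦ m ℤ.⊖ n ⟧ℤ ≈ m ×′ 1# + - (n ×′ 1#)
  ⊖-homo zero    zero    = ≈-sym (-‿inverseʳ _)
  ⊖-homo zero    (suc n) = ≈-sym (+-identityˡ _)
  ⊖-homo (suc m) zero    = ≈-sym (≈-trans (+-congˡ -0#≈0#) (+-identityʳ _))
  ⊖-homo (suc m) (suc n) = begin
    ⟦ suc m ℤ.⊖ suc n ⟧ℤ               ≡⟨ cong ⟦_⟧ℤ (ℤ.[1+m]⊖[1+n]≡m⊖n m n) ⟩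
    ⟦ m ℤ.⊖ n ⟧ℤ                       ≈⟨ ⊖-homo m n ⟩
    m ×′ 1# + - (n ×′ 1#)                ≈⟨ ≈-sym (cancel-1+ _ _) ⟩
    (1# + m ×′ 1#) + - (1# + n ×′ 1#)    ≈⟨ +-cong (≈-sym (1+× m 1#)) (-‿cong (≈-sym (1+× n 1#))) ⟩
    suc m ×′ 1# + - (suc n ×′ 1#)        ∎

  ⟦⟧ℤ-+ : ∀ i j → ⟦ i ℤ.+ j ⟧ℤ ≈ ⟦ i ⟧ℤ + ⟦ j ⟧ℤ
  ⟦⟧ℤ-+ (+ m)      (+ n)      = ×-homo-+ 1# m n
  ⟦⟧ℤ-+ (+ m)      -[1+ n ]   = ⊖-homo m (suc n)
  ⟦⟧ℤ-+ -[1+ m ]   (+ n)      = ≈-trans (⊖-homo n (suc m)) (+-comm _ _)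
  ⟦⟧ℤ-+ -[1+ m ]   -[1+ n ]   = begin
    - (suc (suc (m ℕ.+ n)) ×′ 1#)      ≡⟨ cong (λ k → - (k ×′ 1#)) (sym (cong suc (ℕ.+-suc m n))) ⟩
    - ((suc m ℕ.+ suc n) ×′ 1#)        ≈⟨ -‿cong (×-homo-+ 1# (suc m) (suc n)) ⟩
    - (suc m ×′ 1# + suc n ×′ 1#)       ≈⟨ ≈-sym (⁻¹-∙-comm _ _) ⟩
    - (suc m ×′ 1#) + - (suc n ×′ 1#)   ∎

  ⟦⟧ℤ-neg : ∀ i → ⟦ ℤ.- i ⟧ℤ ≈ - ⟦ i ⟧ℤ
  ⟦⟧ℤ-neg (+ zero)  = ≈-sym -0#≈0#
  ⟦⟧ℤ-neg (+ suc n) = ≈-refl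
  ⟦⟧ℤ-neg -[1+ n ]  = ≈-sym (-‿involutive _)

  ⟦⟧ℤ-* : ∀ i j → ⟦ i ℤ.* j ⟧ℤ ≈ ⟦ i ⟧ℤ * ⟦ j ⟧ℤ
  ⟦⟧ℤ-* (+ m) (+ n) = ≈-trans (reflexive (cong ⟦_⟧ℤ (sym (ℤ.pos-* m n)))) (×1-homo-* m n)
  ⟦⟧ℤ-* (+ m) -[1+ n ] = begin
    ⟦ + m ℤ.* -[1+ n ] ⟧ℤ          ≡⟨ cong ⟦_⟧ℤ (sym (ℤ.neg-distribʳ-* (+ m) (+ suc n))) ⟩
    ⟦ ℤ.- (+ m ℤ.* + suc n) ⟧ℤ     ≈⟨ ⟦⟧ℤ-neg (+ m ℤ.* + suc n) ⟩
    - ⟦ + m ℤ.* + suc n ⟧ℤ         ≈⟨ -‿cong (⟦⟧ℤ-* (+ m) (+ suc n)) ⟩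
    - (m ×′ 1# * suc n ×′ 1#)        ≈⟨ -‿distribʳ-* _ _ ⟩
    m ×′ 1# * - (suc n ×′ 1#)        ∎
  ⟦⟧ℤ-* -[1+ m ] (+ n) = begin
    ⟦ -[1+ m ] ℤ.* + n ⟧ℤ          ≡⟨ cong ⟦_⟧ℤ (sym (ℤ.neg-distribˡ-* (+ suc m) (+ n))) ⟩
    ⟦ ℤ.- (+ suc m ℤ.* + n) ⟧ℤ     ≈⟨ ⟦⟧ℤ-neg (+ suc m ℤ.* + n) ⟩
    - ⟦ + suc m ℤ.* + n ⟧ℤ         ≈⟨ -‿cong (⟦⟧ℤ-* (+ suc m) (+ n)) ⟩
    - (suc m ×′ 1# * n ×′ 1#)        ≈⟨ -‿distribˡ-* _ _ ⟩
    - (suc m ×′ 1#) * n ×′ 1#        ∎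
  ⟦⟧ℤ-* -[1+ m ] -[1+ n ] = begin
    (suc m ℕ.* suc n) ×′ 1#             ≈⟨ ×1-homo-* (suc m) (suc n) ⟩
    suc m ×′ 1# * suc n ×′ 1#            ≈⟨ ≈-sym (-‿involutive _) ⟩
    - (- (suc m ×′ 1# * suc n ×′ 1#))    ≈⟨ -‿cong (-‿distribʳ-* _ _) ⟩
    - (suc m ×′ 1# * - (suc n ×′ 1#))    ≈⟨ -‿distribˡ-* _ _ ⟩
    - (suc m ×′ 1#) * - (suc n ×′ 1#)    ∎

  ⟦⟧ℤ-homomorphism : ℤ.+-*-rawRing -Raw-AlmostCommutative⟶ fromCommutativeRing R
  ⟦⟧ℤ-homomorphism = record
    { ⟦_⟧    = ⟦_⟧ℤ
    ; +-homo = ⟦⟧ℤ-+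
    ; *-homo = ⟦⟧ℤ-*
    ; -‿homo = ⟦⟧ℤ-neg
    ; 0-homo = ≈-refl
    ; 1-homo = ≈-refl
    }

  ⟦⟧ℤ-≟ : ∀ i j → Maybe (⟦ i ⟧ℤ ≈ ⟦ j ⟧ℤ)
  ⟦⟧ℤ-≟ i j with i ℤ.≟ j
  ... | yes i≡j = just (reflexive (cong ⟦_⟧ℤ i≡j))
  ... | no _    = nothing

  open Algebra.Solver.Ring ℤ.+-*-rawRing (fromCommutativeRing R) ⟦⟧ℤ-homomorphism ⟦⟧ℤ-≟ public
    using (Polynomial; solve; _:=_; _:+_; _:*_; _:-_; :-_; _:^_; con)

  :0 :1 : ∀ {n} → Polynomial n
  :0 = con (+ 0)
  :1 = con (+ 1)

-- Fields, and polynomial functions with a degree bound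

module FieldProperties (K : Field) where
  open Field K

  commutativeRing : CommutativeRing 0ℓ 0ℓ
  commutativeRing = record { isCommutativeRing = isCommutativeRing }

  open CommutativeRing commutativeRing public
    using ( +-identityˡ; +-identityʳ; *-assoc; *-comm; *-identityˡ; *-identityʳ
          ; zeroˡ; zeroʳ; -‿inverseʳ; +-commutativeMonoid; *-commutativeMonoid
          ; semiring; commutativeSemiring)
  open IntegerCoefficientSolver commutativeRing public
  open ≡-Reasoning

  x-y≡0⇒x≡y : ∀ x y → x - y ≡ 0# → x ≡ y
  x-y≡0⇒x≡y x y eq = begin
    x             ≡⟨ solve 2 (λ x y → x := (x :- y) :+ y) refl x y ⟩
    (x - y) + y   ≡⟨ cong (_+ y) eq ⟩
    0# + y        ≡⟨ +-identityˡ y ⟩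
    y             ∎

  x≢y⇒x-y≢0 : ∀ {x y} → x ≢ y → x - y ≢ 0#
  x≢y⇒x-y≢0 x≢y = x≢y ∘ x-y≡0⇒x≡y _ _

  *-cancelˡ : ∀ {x} y z → x ≢ 0# → x * y ≡ x * z → y ≡ z
  *-cancelˡ {x} y z x≢0 eq = begin
    y                 ≡⟨ sym (cancel y) ⟩
    x ⁻¹ * (x * y)    ≡⟨ cong (x ⁻¹ *_) eq ⟩
    x ⁻¹ * (x * z)    ≡⟨ cancel z ⟩
    z                 ∎
    where
    cancel : ∀ w → x ⁻¹ * (x * w) ≡ w
    cancel w = begin
      x ⁻¹ * (x * w)   ≡⟨ solve 3 (λ x i w → i :* (x :* w) := (x :* i) :* w) refl x (x ⁻¹) w ⟩
      (x * x ⁻¹) * w   ≡⟨ cong (_* w) (inverseʳ x x≢0) ⟩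
      1# * w           ≡⟨ *-identityˡ w ⟩
      w                ∎

  x*y≡0⇒y≡0 : ∀ {x} y → x ≢ 0# → x * y ≡ 0# → y ≡ 0#
  x*y≡0⇒y≡0 {x} y x≢0 eq = *-cancelˡ y 0# x≢0 (trans eq (sym (zeroʳ x)))

  *-≢0 : ∀ {x y} → x ≢ 0# → y ≢ 0# → x * y ≢ 0#
  *-≢0 {y = y} x≢0 y≢0 eq = y≢0 (x*y≡0⇒y≡0 y x≢0 eq)

  ⁻¹-≢0 : ∀ {x} → x ≢ 0# → x ⁻¹ ≢ 0#
  ⁻¹-≢0 {x} x≢0 eq = 0≢1 (trans (sym (zeroʳ x)) (trans (cong (x *_) (sym eq)) (inverseʳ x x≢0)))

  ^-≢0 : ∀ {x} n → x ≢ 0# → x ^ n ≢ 0#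
  ^-≢0 zero    x≢0 eq = 0≢1 (sym eq)
  ^-≢0 (suc n) x≢0    = *-≢0 x≢0 (^-≢0 n x≢0)

  ^-homo-+ : ∀ x m n → x ^ (m ℕ.+ n) ≡ x ^ m * x ^ n
  ^-homo-+ x zero    n = sym (*-identityˡ _)
  ^-homo-+ x (suc m) n = trans (cong (x *_) (^-homo-+ x m n)) (sym (*-assoc x (x ^ m) (x ^ n)))

  1^n≡1 : ∀ n → 1# ^ n ≡ 1#
  1^n≡1 zero    = refl
  1^n≡1 (suc n) = trans (*-identityˡ _) (1^n≡1 n)

  ^-distrib-* : ∀ x y n → (x * y) ^ n ≡ x ^ n * y ^ n
  ^-distrib-* x y zero    = sym (*-identityˡ 1#)
  ^-distrib-* x y (suc n) = trans (cong ((x * y) *_) (^-distrib-* x y n))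
    (solve 4 (λ x y a b → (x :* y) :* (a :* b) := (x :* a) :* (y :* b)) refl x y (x ^ n) (y ^ n))

  ^-* : ∀ x m n → (x ^ m) ^ n ≡ x ^ (m ℕ.* n)
  ^-* x zero    n = 1^n≡1 n
  ^-* x (suc m) n = begin
    (x * x ^ m) ^ n         ≡⟨ ^-distrib-* x (x ^ m) n ⟩
    x ^ n * (x ^ m) ^ n     ≡⟨ cong (x ^ n *_) (^-* x m n) ⟩
    x ^ n * x ^ (m ℕ.* n)   ≡⟨ sym (^-homo-+ x n (m ℕ.* n)) ⟩
    x ^ (n ℕ.+ m ℕ.* n)     ∎

  -- Polynomial functions carry their Horner decomposition; DegLess d means degree < d.
  data DegLess : ℕ → (Carrier → Carrier) → Set where
    vanishing : ∀ {f} → (∀ x → f x ≡ 0#) → DegLess 0 f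
    horner    : ∀ {d f g} c → DegLess d g → (∀ x → f x ≡ c + x * g x) → DegLess (suc d) f

  data Monic : ℕ → (Carrier → Carrier) → Set where
    one    : ∀ {f} → (∀ x → f x ≡ 1#) → Monic 0 f
    horner : ∀ {d f g} c → Monic d g → (∀ x → f x ≡ c + x * g x) → Monic (suc d) f

  monic-resp : ∀ {d f g} → (∀ x → g x ≡ f x) → Monic d f → Monic d g
  monic-resp g≗f (one f≡1)        = one (λ x → trans (g≗f x) (f≡1 x))
  monic-resp g≗f (horner c m eq)  = horner c m (λ x → trans (g≗f x) (eq x))

  vanishing-degLess : ∀ d {f} → (∀ x → f x ≡ 0#) → DegLess d f
  vanishing-degLess zero    f≡0 = vanishing f≡0
  vanishing-degLess (suc d) f≡0 = horner 0# (vanishing-degLess d {λ _ → 0#} (λ _ → refl))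
    (λ x → trans (f≡0 x) (solve 1 (λ x → :0 := :0 :+ x :* :0) refl x))

  degLess-mono : ∀ {d e f} → d ℕ.≤ e → DegLess d f → DegLess e f
  degLess-mono {e = e} z≤n   (vanishing f≡0) = vanishing-degLess e f≡0
  degLess-mono (s≤s d≤e) (horner c l eq) = horner c (degLess-mono d≤e l) eq

  degLess-*ˡ : ∀ {d f} a → DegLess d f → DegLess d (λ x → a * f x)
  degLess-*ˡ a (vanishing f≡0) = vanishing (λ x → trans (cong (a *_) (f≡0 x)) (zeroʳ a))
  degLess-*ˡ a (horner {g = g} c l eq) = horner (a * c) (degLess-*ˡ a l) (λ x → trans (cong (a *_) (eq x))
    (solve 4 (λ a c x y → a :* (c :+ x :* y) := a :* c :+ x :* (a :* y)) refl a c x (g x)))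

  degLess-const : ∀ c → DegLess 1 (λ _ → c)
  degLess-const c = horner c (vanishing {λ _ → 0#} (λ _ → refl))
    (λ x → solve 2 (λ c x → c := c :+ x :* :0) refl c x)

  monic⇒degLess : ∀ {d f} → Monic d f → DegLess (suc d) f
  monic⇒degLess (one f≡1)       = horner 1# (vanishing {λ _ → 0#} (λ _ → refl))
    (λ x → trans (f≡1 x) (solve 1 (λ x → :1 := :1 :+ x :* :0) refl x))
  monic⇒degLess (horner c m eq) = horner c (monic⇒degLess m) eq

  monic-+ : ∀ {d f h} → Monic d f → DegLess d h → Monic d (λ x → f x + h x)
  monic-+ (one f≡1) (vanishing h≡0) = one (λ x → trans (cong₂ _+_ (f≡1 x) (h≡0 x)) (+-identityʳ 1#))
  monic-+ (horner {g = g} c m eq) (horner {g = k} b l eq′) = horner (c + b) (monic-+ m l)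
    (λ x → trans (cong₂ _+_ (eq x) (eq′ x))
      (solve 5 (λ c b x y z → (c :+ x :* y) :+ (b :+ x :* z) := (c :+ b) :+ x :* (y :+ z)) refl c b x (g x) (k x)))

  monic-x* : ∀ {d f} → Monic d f → Monic (suc d) (λ x → x * f x)
  monic-x* m = horner 0# m (λ x → sym (+-identityˡ _))

  -- Peel one Horner step off f: (c + x f′) g = x (f′ g) + c g, and the degree of c g is too low to
  -- affect the leading term.
  monic-* : ∀ {d e f g} → Monic d f → Monic e g → Monic (d ℕ.+ e) (λ x → f x * g x)
  monic-* {g = g} (one f≡1) m = monic-resp (λ x → trans (cong (_* g x) (f≡1 x)) (*-identityˡ _)) m
  monic-* {suc d} {e} {g = g} (horner {g = f′} c m eq) n = monic-resp
    (λ x → trans (cong (_* g x) (eq x))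
      (solve 4 (λ c x y z → (c :+ x :* y) :* z := x :* (y :* z) :+ c :* z) refl c x (f′ x) (g x)))
    (monic-+ (monic-x* (monic-* m n)) (degLess-mono (s≤s (ℕ.m≤n+m e d)) (degLess-*ˡ c (monic⇒degLess n))))

  monic-^ : ∀ {d f} n → Monic d f → Monic (n ℕ.* d) (λ x → f x ^ n)
  monic-^ zero    m = one (λ _ → refl)
  monic-^ (suc n) m = monic-* m (monic-^ n m)

  monic-x^ : ∀ n → Monic n (λ x → x ^ n)
  monic-x^ zero    = one (λ _ → refl)
  monic-x^ (suc n) = monic-x* (monic-x^ n)

  -- Synthetic division: if f = c + x g and h is the quotient for g, the quotient for f is g + a h,
  -- still monic because h has smaller degree than g.
  monic-factor : ∀ {d f} → Monic (suc d) f → ∀ a →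
                 ∃ λ g → Monic d g × (∀ x → f x - f a ≡ (x - a) * g x)
  monic-factor {zero} {f} (horner {g = g} c (one g≡1) eq) a = (λ _ → 1#) , one (λ _ → refl) , λ x → begin
    f x - f a                              ≡⟨ cong₂ _-_ (eq x) (eq a) ⟩
    (c + x * g x) - (c + a * g a)          ≡⟨ cong₂ (λ y z → (c + x * y) - (c + a * z)) (g≡1 x) (g≡1 a) ⟩
    (c + x * 1#) - (c + a * 1#)            ≡⟨ solve 3 (λ c x a → (c :+ x :* :1) :- (c :+ a :* :1) := (x :- a) :* :1) refl c x a ⟩
    (x - a) * 1#                           ∎
  monic-factor {suc d} {f} (horner {g = g} c m eq) a with monic-factor m a
  ... | h , mh , fac = (λ x → g x + a * h x) , monic-+ m (degLess-*ˡ a (monic⇒degLess mh)) , λ x → begin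
    f x - f a                                  ≡⟨ cong₂ _-_ (eq x) (eq a) ⟩
    (c + x * g x) - (c + a * g a)              ≡⟨ solve 5 (λ c x a y z → (c :+ x :* y) :- (c :+ a :* z) := (x :- a) :* y :+ a :* (y :- z)) refl c x a (g x) (g a) ⟩
    (x - a) * g x + a * (g x - g a)            ≡⟨ cong (λ w → (x - a) * g x + a * w) (fac x) ⟩
    (x - a) * g x + a * ((x - a) * h x)        ≡⟨ solve 4 (λ x a y z → (x :- a) :* y :+ a :* ((x :- a) :* z) := (x :- a) :* (y :+ a :* z)) refl x a (g x) (h x) ⟩
    (x - a) * (g x + a * h x)                  ∎

  -- Divide by the linear factor of `e zero`; the other roots survive in the quotient, since that
  -- factor does not vanish at them.
  monic-roots≤degree : ∀ {d f n} → Monic d f → (e : Fin n → Carrier) → Injective _≡_ _≡_ e →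
                       (∀ i → f (e i) ≡ 0#) → n ℕ.≤ d
  monic-roots≤degree {n = zero}  m e inj root = z≤n
  monic-roots≤degree {zero}  {n = suc n} (one f≡1) e inj root = ⊥-elim (0≢1 (trans (sym (root zero)) (f≡1 (e zero))))
  monic-roots≤degree {suc d} {f} {suc n} m e inj root with monic-factor m (e zero)
  ... | g , mg , fac = s≤s (monic-roots≤degree mg (e ∘ suc) (λ eq → Fin.suc-injective (inj eq)) root′)
    where
    e≢e₀ : ∀ i → e (suc i) ≢ e zero
    e≢e₀ i eq with () ← inj eq
    root′ : ∀ i → g (e (suc i)) ≡ 0#
    root′ i = x*y≡0⇒y≡0 _ (x≢y⇒x-y≢0 (e≢e₀ i)) (begin
      (e (suc i) - e zero) * g (e (suc i))  ≡⟨ sym (fac (e (suc i))) ⟩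
      f (e (suc i)) - f (e zero)            ≡⟨ cong₂ _-_ (root (suc i)) (root zero) ⟩
      0# - 0#                               ≡⟨ -‿inverseʳ 0# ⟩
      0#                                    ∎)

-- Binomial coefficients modulo p and the Frobenius map

p∣n!⇒p≤n : ∀ {p} n → Prime p → p ∣ n ! → p ℕ.≤ n
p∣n!⇒p≤n {p} zero    pp p∣1 = ⊥-elim (ℕ.<⇒≱ (ℕ.nonTrivial⇒n>1 p {{prime⇒nonTrivial pp}}) (∣⇒≤ p∣1))
p∣n!⇒p≤n     (suc n) pp p∣  =
  [ ∣⇒≤ , ℕ.m≤n⇒m≤1+n ∘ p∣n!⇒p≤n n pp ]′ (euclidsLemma (suc n) (n !) pp p∣)

-- p divides p! = C(p, k) k! (p - k)! but neither factorial, both being of numbers below p.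
prime∣C : ∀ {p k} → Prime p → 0 ℕ.< k → k ℕ.< p → p ∣ p C k
prime∣C {suc m} {k@(suc k′)} pp 0<k k<p with euclidsLemma (suc m C k) (k ! ℕ.* (suc m ℕ.∸ k) !) pp
  (subst (suc m ∣_) (sym C*k![p-k]!≡p!) (m∣m*n (m !)))
  where
  C*k![p-k]!≡p! : (suc m C k) ℕ.* (k ! ℕ.* (suc m ℕ.∸ k) !) ≡ suc m !
  C*k![p-k]!≡p! = trans (cong (ℕ._* (k ! ℕ.* (suc m ℕ.∸ k) !)) (nCk≡n!/k![n-k]! (ℕ.<⇒≤ k<p)))
    (m/n*n≡m {{ k ℕ.!* (suc m ℕ.∸ k) !≢0 }} (k![n∸k]!∣n! (ℕ.<⇒≤ k<p)))
... | inj₁ p∣C = p∣C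
... | inj₂ p∣k![p-k]! with euclidsLemma (k !) ((suc m ℕ.∸ k) !) pp p∣k![p-k]!
...   | inj₁ p∣k!     = ⊥-elim (ℕ.<⇒≱ k<p (p∣n!⇒p≤n k pp p∣k!))
...   | inj₂ p∣[p-k]! = ⊥-elim (ℕ.<⇒≱ (s≤s (ℕ.m∸n≤m m k′)) (p∣n!⇒p≤n (suc m ℕ.∸ k) pp p∣[p-k]!))

PowerAdditive : Field → ℕ → Set
PowerAdditive K n = ∀ x y → (x + y) ^ n ≡ x ^ n + y ^ n
  where open Field K

module Frobenius (K : Field) where
  open Field K
  open FieldProperties K
  open Algebra.Properties.Semiring.Mult semiring using (×-homo-1; ×-assoc-*; ×1-homo-*) renaming (_×_ to _×′_)
  open Algebra.Properties.Semiring.Exp semiring using () renaming (_^_ to _^′_)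
  module Binomial = Algebra.Properties.CommutativeSemiring.Binomial commutativeSemiring
  open Algebra.Properties.CommutativeMonoid.Sum +-commutativeMonoid
  open ≡-Reasoning

  ^≡^′ : ∀ x n → x ^ n ≡ x ^′ n
  ^≡^′ x zero    = refl
  ^≡^′ x (suc n) = cong (x *_) (^≡^′ x n)

  ×′-vanish : ∀ {p n} x → p ×′ 1# ≡ 0# → p ∣ n → n ×′ x ≡ 0#
  ×′-vanish {p} {n} x p≡0 (divides k n≡k*p) = begin
    n ×′ x                      ≡⟨ cong (n ×′_) (sym (*-identityˡ x)) ⟩
    n ×′ (1# * x)               ≡⟨ sym (×-assoc-* n 1# x) ⟩
    (n ×′ 1#) * x               ≡⟨ cong (λ m → (m ×′ 1#) * x) n≡k*p ⟩
    ((k ℕ.* p) ×′ 1#) * x       ≡⟨ cong (_* x) (×1-homo-* k p) ⟩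
    ((k ×′ 1#) * (p ×′ 1#)) * x ≡⟨ cong (λ z → ((k ×′ 1#) * z) * x) p≡0 ⟩
    ((k ×′ 1#) * 0#) * x        ≡⟨ solve 2 (λ k x → (k :* :0) :* x := :0) refl (k ×′ 1#) x ⟩
    0#                          ∎

  -- In the binomial theorem `prime∣C` removes all terms but the outer two; index 0 is y^p and the
  -- last index is x^p.
  ^p-homo-+ : ∀ {p} → Prime p → p ×′ 1# ≡ 0# → PowerAdditive K p
  ^p-homo-+ {zero}  pp _ = ⊥-elim (ℕ.≢-nonZero⁻¹ 0 {{prime⇒nonZero pp}} refl)
  ^p-homo-+ {suc m} pp p≡0 x y = begin
    (x + y) ^ suc m                         ≡⟨ ^≡^′ (x + y) (suc m) ⟩
    (x + y) ^′ suc m                        ≡⟨ Binomial.theorem (suc m) x y ⟩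
    term zero + sum (term ∘ suc)            ≡⟨ cong₂ _+_ first (trans (sum-init-last (term ∘ suc)) (cong₂ _+_ middle final)) ⟩
    y ^ suc m + (0# + x ^ suc m)            ≡⟨ solve 2 (λ a b → a :+ (:0 :+ b) := b :+ a) refl (y ^ suc m) (x ^ suc m) ⟩
    x ^ suc m + y ^ suc m                   ∎
    where
    term = Binomial.binomialTerm x y (suc m)
    first : term zero ≡ y ^ suc m
    first = trans (×-homo-1 _) (trans (*-identityˡ _) (sym (^≡^′ y (suc m))))
    middle : sum (term ∘ suc ∘ inject₁) ≡ 0#
    middle = trans (sum-cong-≗ {m} (λ i → ×′-vanish _ p≡0
      (prime∣C pp (s≤s z≤n) (s≤s (subst (ℕ._< m) (sym (Fin.toℕ-inject₁ i)) (Fin.toℕ<n i))))))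
      (sum-replicate-zero m)
    final : term (suc (fromℕ m)) ≡ x ^ suc m
    final = begin
      (suc m C suc (toℕ (fromℕ m))) ×′ (x ^′ suc (toℕ (fromℕ m)) * y ^′ (m ℕ.∸ toℕ (fromℕ m)))
        ≡⟨ cong (λ k → (suc m C suc k) ×′ (x ^′ suc k * y ^′ (m ℕ.∸ k))) (Fin.toℕ-fromℕ m) ⟩
      (suc m C suc m) ×′ (x ^′ suc m * y ^′ (m ℕ.∸ m))
        ≡⟨ cong₂ (λ n k → n ×′ (x ^′ suc m * y ^′ k)) (nCn≡1 (suc m)) (ℕ.n∸n≡0 m) ⟩
      1 ×′ (x ^′ suc m * 1#)  ≡⟨ trans (×-homo-1 _) (*-identityʳ _) ⟩
      x ^′ suc m              ≡⟨ sym (^≡^′ x (suc m)) ⟩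
      x ^ suc m               ∎

  ^p^k-homo-+ : ∀ {p} → Prime p → p ×′ 1# ≡ 0# → ∀ k → PowerAdditive K (p ℕ.^ k)
  ^p^k-homo-+ pp p≡0 zero x y = solve 2 (λ x y → (x :+ y) :* :1 := x :* :1 :+ y :* :1) refl x y
  ^p^k-homo-+ {p} pp p≡0 (suc k) x y = begin
    (x + y) ^ (p ℕ.* p ℕ.^ k)                     ≡⟨ sym (^-* (x + y) p (p ℕ.^ k)) ⟩
    ((x + y) ^ p) ^ (p ℕ.^ k)                     ≡⟨ cong (_^ (p ℕ.^ k)) (^p-homo-+ pp p≡0 x y) ⟩
    (x ^ p + y ^ p) ^ (p ℕ.^ k)                   ≡⟨ ^p^k-homo-+ pp p≡0 k (x ^ p) (y ^ p) ⟩
    (x ^ p) ^ (p ℕ.^ k) + (y ^ p) ^ (p ℕ.^ k)     ≡⟨ cong₂ _+_ (^-* x p (p ℕ.^ k)) (^-* y p (p ℕ.^ k)) ⟩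
    x ^ (p ℕ.* p ℕ.^ k) + y ^ (p ℕ.* p ℕ.^ k)     ∎

  [p^k]×1≡[p×1]^k : ∀ p k → (p ℕ.^ k) ×′ 1# ≡ (p ×′ 1#) ^ k
  [p^k]×1≡[p×1]^k p zero    = +-identityʳ 1#
  [p^k]×1≡[p×1]^k p (suc k) = trans (×1-homo-* p (p ℕ.^ k)) (cong ((p ×′ 1#) *_) ([p^k]×1≡[p×1]^k p k))

-- Sums and products over an enumerated type

module FiniteSum {A : Set} {N : ℕ} (enum : A ↔ Fin N) (M : CommutativeMonoid 0ℓ 0ℓ) where
  open CommutativeMonoid M using (_∙_; ε; _≈_; ∙-cong; identityʳ) renaming (Carrier to B; refl to ≈-refl; trans to ≈-trans; reflexive to ≈-reflexive; sym to ≈-sym)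
  open Algebra.Properties.CommutativeMonoid.Sum M
  open Inverse enum using (to; from; strictlyInverseˡ; strictlyInverseʳ)

  from-injective : ∀ {i j} → from i ≡ from j → i ≡ j
  from-injective {i} {j} eq = trans (sym (strictlyInverseˡ i)) (trans (cong to eq) (strictlyInverseˡ j))

  infix 4 _≟_
  _≟_ : DecidableEquality A
  x ≟ y with to x Fin.≟ to y
  ... | yes eq = yes (trans (sym (strictlyInverseʳ x)) (trans (cong from eq) (strictlyInverseʳ y)))
  ... | no neq = no (neq ∘ cong to)

  total : (A → B) → B
  total g = sum (g ∘ from)

  total-cong : ∀ {g h} → (∀ x → g x ≈ h x) → total g ≈ total h
  total-cong g≈h = sum-cong-≋ (g≈h ∘ from)

  total-∙ : ∀ g h → total (λ x → g x ∙ h x) ≈ total g ∙ total h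
  total-∙ g h = ∑-distrib-+ (g ∘ from) (h ∘ from)

  -- Conjugation with the enumeration turns the bijection π into a permutation of the indices.
  total-permute : ∀ g (π π⁻¹ : A → A) → (∀ x → π (π⁻¹ x) ≡ x) → (∀ x → π⁻¹ (π x) ≡ x) →
                  total (g ∘ π) ≈ total g
  total-permute g π π⁻¹ inverseˡ inverseʳ = ≈-sym (≈-trans (sum-permute (g ∘ from) σ)
    (sum-cong-≋ (λ i → ≈-reflexive (cong g (strictlyInverseʳ (π (from i)))))))
    where
    conj : ∀ (f h : A → A) → (∀ x → f (h x) ≡ x) → ∀ i → to (f (from (to (h (from i))))) ≡ i
    conj f h f∘h i = trans (cong (to ∘ f) (strictlyInverseʳ (h (from i)))) (trans (cong to (f∘h (from i))) (strictlyInverseˡ i))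
    σ = permutation (to ∘ π ∘ from) (to ∘ π⁻¹ ∘ from) (conj π π⁻¹ inverseˡ) (conj π⁻¹ π inverseʳ)

  private
    sum-single : ∀ {n} (i : Fin n) b → sum (λ j → if does (j Fin.≟ i) then b else ε) ≈ b
    sum-single {suc n} i b = ≈-trans (sum-remove {i = i} (λ j → if does (j Fin.≟ i) then b else ε))
      (≈-trans (∙-cong at off) (identityʳ b))
      where
      at : (if does (i Fin.≟ i) then b else ε) ≈ b
      at rewrite dec-true (i Fin.≟ i) refl = ≈-refl
      off : sum (λ j → if does (punchIn i j Fin.≟ i) then b else ε) ≈ ε
      off = ≈-trans (sum-cong-≋ {n} λ j → ≈-reflexive (cong (λ c → if c then b else ε)
        (dec-false (punchIn i j Fin.≟ i) (Fin.punchInᵢ≢i i j)))) (sum-replicate-zero n)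

  total-single : ∀ a b → total (λ x → if does (x ≟ a) then b else ε) ≈ b
  total-single a b = ≈-trans (sum-cong-≋ same) (sum-single (to a) b)
    where
    same : ∀ i → (if does (from i ≟ a) then b else ε) ≈ (if does (i Fin.≟ to a) then b else ε)
    same i with from i ≟ a
    ... | yes eq  rewrite dec-true (i Fin.≟ to a) (trans (sym (strictlyInverseˡ i)) (cong to eq)) = ≈-refl
    ... | no  neq rewrite dec-false (i Fin.≟ to a) (λ eq → neq (trans (cong from eq) (strictlyInverseʳ a))) = ≈-refl

-- Characteristic of a finite field, and x^N = x

module FiniteFieldProperties {N : ℕ} (L : FiniteField N) where
  open FiniteField L
  open FieldProperties field′
  open Frobenius field′
  open Algebra.Properties.Semiring.Mult semiring using () renaming (_×_ to _×′_)
  open Algebra.Properties.CommutativeMonoid.Sum *-commutativeMonoid using () renaming (sum to product; sum-replicate to product-replicate)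
  open Algebra.Properties.CommutativeMonoid.Sum +-commutativeMonoid using (sum-replicate)
  module ∑ = FiniteSum enumeration +-commutativeMonoid
  module ∏ = FiniteSum enumeration *-commutativeMonoid
  open ∑ using (_≟_)
  open ≡-Reasoning

  +-fixed⇒0 : ∀ {x y} → x + y ≡ x → y ≡ 0#
  +-fixed⇒0 {x} {y} eq = begin
    y             ≡⟨ solve 2 (λ x y → y := (x :+ y) :- x) refl x y ⟩
    (x + y) - x   ≡⟨ cong (_- x) eq ⟩
    x - x         ≡⟨ -‿inverseʳ x ⟩
    0#            ∎

  shift-back : ∀ x c → (x - c) + c ≡ x
  shift-back = solve 2 (λ x c → (x :- c) :+ c := x) refl

  shift-forth : ∀ x c → (x + c) - c ≡ x
  shift-forth = solve 2 (λ x c → (x :+ c) :- c := x) refl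

  -- The translation x ↦ x + 1 permutes L, hence ∑ x = ∑ (x + 1) = ∑ x + N · 1.
  N×1≡0 : N ×′ 1# ≡ 0#
  N×1≡0 = +-fixed⇒0 (begin
    ∑.total (λ x → x) + N ×′ 1#                  ≡⟨ cong (∑.total (λ x → x) +_) (sym (sum-replicate N)) ⟩
    ∑.total (λ x → x) + ∑.total (λ _ → 1#)       ≡⟨ sym (∑.total-∙ (λ x → x) (λ _ → 1#)) ⟩
    ∑.total (λ x → x + 1#)                       ≡⟨ ∑.total-permute (λ x → x) (_+ 1#) (_- 1#) (λ x → shift-back x 1#) (λ x → shift-forth x 1#) ⟩
    ∑.total (λ x → x)                            ∎)

  inverseˡ : ∀ {x} → x ≢ 0# → ∀ y → x * (x ⁻¹ * y) ≡ y
  inverseˡ {x} x≢0 y = trans (sym (*-assoc x (x ⁻¹) y)) (trans (cong (_* y) (inverseʳ x x≢0)) (*-identityˡ y))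

  inverseˡ′ : ∀ {x} → x ≢ 0# → ∀ y → x ⁻¹ * (x * y) ≡ y
  inverseˡ′ {x} x≢0 y = *-cancelˡ _ _ x≢0 (inverseˡ x≢0 (x * y))

  -- With 0 replaced by 1, the product over all of L becomes the product of its nonzero elements,
  -- which can be cancelled.
  unit : Carrier → Carrier
  unit x = if does (x ∏.≟ 0#) then 1# else x

  product-≢0 : ∀ {n} (g : Fin n → Carrier) → (∀ i → g i ≢ 0#) → product g ≢ 0#
  product-≢0 {zero}  g g≢0 eq = 0≢1 (sym eq)
  product-≢0 {suc n} g g≢0 = *-≢0 (g≢0 zero) (product-≢0 (g ∘ suc) (g≢0 ∘ suc))

  unit-≢0 : ∀ x → unit x ≢ 0#
  unit-≢0 x with x ∏.≟ 0#
  ... | yes _  = 0≢1 ∘ sym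
  ... | no x≢0 = x≢0

  -- Multiplication by a ≢ 0 permutes L and fixes 0; comparing the products of the nonzero
  -- elements shows that the factor a, taken once for every nonzero element, gives 1.
  x^N≡x : ∀ x → x ^ N ≡ x
  x^N≡x a with a ≟ 0#
  ... | yes refl = 0^n≡0 (Inverse.to enumeration 0#)
    where
    0^n≡0 : ∀ {n} → Fin n → 0# ^ n ≡ 0#
    0^n≡0 {suc n} _ = zeroˡ _
  ... | no a≢0 = begin
    a ^ N                                      ≡⟨ trans (^≡^′ a N) (sym (product-replicate N)) ⟩
    ∏.total (λ _ → a)                          ≡⟨ ∏.total-cong split ⟩
    ∏.total (λ x → factor x * cofactor x)      ≡⟨ ∏.total-∙ factor cofactor ⟩
    ∏.total factor * ∏.total cofactor          ≡⟨ cong₂ _*_ factors≡1 (∏.total-single 0# a) ⟩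
    1# * a                                     ≡⟨ *-identityˡ a ⟩
    a                                          ∎
    where
    factor cofactor : Carrier → Carrier
    factor   x = if does (x ∏.≟ 0#) then 1# else a
    cofactor x = if does (x ∏.≟ 0#) then a else 1#
    split : ∀ x → a ≡ factor x * cofactor x
    split x with x ∏.≟ 0#
    ... | yes _ = sym (*-identityˡ a)
    ... | no _  = sym (*-identityʳ a)
    unit-* : ∀ x → unit (a * x) ≡ unit x * factor x
    unit-* x with x ∏.≟ 0#
    ... | yes refl rewrite dec-true (a * 0# ∏.≟ 0#) (zeroʳ a) = sym (*-identityˡ 1#)
    ... | no x≢0   rewrite dec-false (a * x ∏.≟ 0#) (*-≢0 a≢0 x≢0) = *-comm a x
    factors≡1 : ∏.total factor ≡ 1#
    factors≡1 = *-cancelˡ _ _ (product-≢0 _ (unit-≢0 ∘ Inverse.from enumeration)) (begin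
      ∏.total unit * ∏.total factor        ≡⟨ sym (∏.total-∙ unit factor) ⟩
      ∏.total (λ x → unit x * factor x)    ≡⟨ ∏.total-cong (λ x → sym (unit-* x)) ⟩
      ∏.total (λ x → unit (a * x))         ≡⟨ ∏.total-permute unit (a *_) (a ⁻¹ *_) (inverseˡ a≢0) (inverseˡ′ a≢0) ⟩
      ∏.total unit                         ≡⟨ sym (*-identityʳ _) ⟩
      ∏.total unit * 1#                    ∎)

  -- (p · 1)^k = N · 1 = 0, and a field has no nonzero nilpotent elements.
  p×1≡0 : ∀ p k → N ≡ p ℕ.^ k → p ×′ 1# ≡ 0#
  p×1≡0 p k N≡p^k = decidable-stable (p ×′ 1# ≟ 0#) (λ p≢0 → ^-≢0 k p≢0
    (trans (sym ([p^k]×1≡[p×1]^k p k)) (trans (cong (_×′ 1#) (sym N≡p^k)) N×1≡0)))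

-- Power sums over F_q inside F_(q³)

-- Here m is q - 1, which avoids truncated subtraction in exponents.
module Subfield {N : ℕ} (L : FiniteField N) (m : ℕ) (1≤m : 1 ℕ.≤ m) (N≡q³ : N ≡ suc m ℕ.^ 3)
  (frobenius-+ : PowerAdditive (FiniteField.field′ L) (suc m))
  where
  open FiniteField L
  open FieldProperties field′
  open FiniteFieldProperties L
  open ∑ using (_≟_)
  open Algebra.Properties.Semiring.Sum semiring using (*-distribˡ-sum)
  open ≡-Reasoning

  q : ℕ
  q = suc m

  frobenius³ : ∀ x → ((x ^ q) ^ q) ^ q ≡ x
  frobenius³ x = begin
    -- `q ^ 3` unfolds to `q * (q * (q * 1))`; the exponent 1 supplies the last factor.
    ((x ^ q) ^ q) ^ q                  ≡⟨ sym (*-identityʳ _) ⟩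
    (((x ^ q) ^ q) ^ q) ^ 1            ≡⟨ ^-* _ q 1 ⟩
    ((x ^ q) ^ q) ^ (q ℕ.^ 1)          ≡⟨ ^-* _ q (q ℕ.^ 1) ⟩
    (x ^ q) ^ (q ℕ.^ 2)                ≡⟨ ^-* _ q (q ℕ.^ 2) ⟩
    x ^ (q ℕ.^ 3)                      ≡⟨ cong (x ^_) (sym N≡q³) ⟩
    x ^ N                              ≡⟨ x^N≡x x ⟩
    x                                  ∎

  -- Additivity is applied to (x - y) + y, which avoids evaluating (-1)^q by the parity of q.
  frobenius-- : ∀ x y → (x - y) ^ q ≡ x ^ q - y ^ q
  frobenius-- x y = begin
    (x - y) ^ q                        ≡⟨ sym (shift-forth _ (y ^ q)) ⟩
    ((x - y) ^ q + y ^ q) - y ^ q      ≡⟨ cong (_- y ^ q) (sym (frobenius-+ (x - y) y)) ⟩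
    ((x - y) + y) ^ q - y ^ q          ≡⟨ cong (λ z → z ^ q - y ^ q) (shift-back x y) ⟩
    x ^ q - y ^ q                      ∎

  Fq : Carrier → Set
  Fq = InFq L q

  Fq? : ∀ x → Dec (Fq x)
  Fq? x = x ^ q ≟ x

  Fq-* : ∀ {x y} → Fq x → Fq y → Fq (x * y)
  Fq-* {x} {y} x∈ y∈ = trans (^-distrib-* x y q) (cong₂ _*_ x∈ y∈)

  Fq-+ : ∀ {x y} → Fq x → Fq y → Fq (x + y)
  Fq-+ {x} {y} x∈ y∈ = trans (frobenius-+ x y) (cong₂ _+_ x∈ y∈)

  Fq-- : ∀ {x y} → Fq x → Fq y → Fq (x - y)
  Fq-- {x} {y} x∈ y∈ = trans (frobenius-- x y) (cong₂ _-_ x∈ y∈)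

  Fq-⁻¹ : ∀ {x} → x ≢ 0# → Fq x → Fq (x ⁻¹)
  Fq-⁻¹ {x} x≢0 x∈ = *-cancelˡ _ _ x≢0 (begin
    x * (x ⁻¹) ^ q        ≡⟨ cong (_* (x ⁻¹) ^ q) (sym x∈) ⟩
    x ^ q * (x ⁻¹) ^ q    ≡⟨ sym (^-distrib-* x (x ⁻¹) q) ⟩
    (x * x ⁻¹) ^ q        ≡⟨ cong (_^ q) (inverseʳ x x≢0) ⟩
    1# ^ q                ≡⟨ 1^n≡1 q ⟩
    1#                    ≡⟨ sym (inverseʳ x x≢0) ⟩
    x * x ⁻¹              ∎)

  Fq-^m : ∀ {x} → x ≢ 0# → Fq x → x ^ m ≡ 1#
  Fq-^m {x} x≢0 x∈ = *-cancelˡ _ _ x≢0 (trans x∈ (sym (*-identityʳ x)))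

  -- Extension by 0 turns a sum over F_q into one over the enumerated L, so additivity and
  -- reindexing are inherited from `∑.total`.
  restrict : (Carrier → Carrier) → Carrier → Carrier
  restrict g x = if does (Fq? x) then g x else 0#

  -- Abstract, so that the summand can be inferred from ∑q g.
  abstract
    ∑q : (Carrier → Carrier) → Carrier
    ∑q g = ∑.total (restrict g)

    ∑q-cong : ∀ {g h} → (∀ x → Fq x → g x ≡ h x) → ∑q g ≡ ∑q h
    ∑q-cong {g} {h} g≡h = ∑.total-cong pointwise
      where
      pointwise : ∀ x → restrict g x ≡ restrict h x
      pointwise x with Fq? x
      ... | yes x∈ = g≡h x x∈
      ... | no _   = refl

    ∑q-+ : ∀ g h → ∑q (λ x → g x + h x) ≡ ∑q g + ∑q h
    ∑q-+ g h = trans (∑.total-cong pointwise) (∑.total-∙ (restrict g) (restrict h))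
      where
      pointwise : ∀ x → restrict (λ x → g x + h x) x ≡ restrict g x + restrict h x
      pointwise x with Fq? x
      ... | yes _ = refl
      ... | no _  = sym (+-identityˡ 0#)

    ∑q-* : ∀ c g → ∑q (λ x → c * g x) ≡ c * ∑q g
    ∑q-* c g = trans (∑.total-cong pointwise) (sym (*-distribˡ-sum c (restrict g ∘ Inverse.from enumeration)))
      where
      pointwise : ∀ x → restrict (λ x → c * g x) x ≡ c * restrict g x
      pointwise x with Fq? x
      ... | yes _ = refl
      ... | no _  = sym (zeroʳ c)

    ∑q-at-0 : ∀ c → ∑q (λ x → if does (x ≟ 0#) then c else 0#) ≡ c
    ∑q-at-0 c = trans (∑.total-cong pointwise) (∑.total-single 0# c)
      where
      pointwise : ∀ x → restrict (λ x → if does (x ≟ 0#) then c else 0#) x ≡ (if does (x ≟ 0#) then c else 0#)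
      pointwise x with Fq? x
      ... | yes _ = refl
      ... | no x∉ with x ≟ 0#
      ...   | yes refl = ⊥-elim (x∉ (zeroˡ _))
      ...   | no _     = refl

    -- f need only be invertible on F_q: continued by the identity elsewhere, it is a permutation of
    -- L.
    ∑q-permute : ∀ g (f f⁻¹ : Carrier → Carrier) →
                 (∀ x → Fq x → Fq (f x)) → (∀ x → Fq x → Fq (f⁻¹ x)) →
                 (∀ x → Fq x → f (f⁻¹ x) ≡ x) → (∀ x → Fq x → f⁻¹ (f x) ≡ x) →
                 ∑q (g ∘ f) ≡ ∑q g
    ∑q-permute g f f⁻¹ f-Fq f⁻¹-Fq f∘f⁻¹ f⁻¹∘f =
      trans (∑.total-cong pointwise) (∑.total-permute (restrict g) (extend f) (extend f⁻¹)
        (extend-inverse f f⁻¹ f⁻¹-Fq f∘f⁻¹) (extend-inverse f⁻¹ f f-Fq f⁻¹∘f))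
      where
      extend : (Carrier → Carrier) → Carrier → Carrier
      extend h x = if does (Fq? x) then h x else x
      extend-inverse : ∀ h k → (∀ x → Fq x → Fq (k x)) → (∀ x → Fq x → h (k x) ≡ x) → ∀ x → extend h (extend k x) ≡ x
      extend-inverse h k k-Fq h∘k x with Fq? x
      ... | yes x∈ rewrite dec-true (Fq? (k x)) (k-Fq x x∈) = h∘k x x∈
      ... | no x∉  rewrite dec-false (Fq? x) x∉ = refl
      pointwise : ∀ x → restrict (g ∘ f) x ≡ restrict g (extend f x)
      pointwise x with Fq? x
      ... | yes x∈ rewrite dec-true (Fq? (f x)) (f-Fq x x∈) = refl
      ... | no x∉  rewrite dec-false (Fq? x) x∉ = refl

  ∑q-1 : ∑q (λ _ → 1#) ≡ 0#
  ∑q-1 = +-fixed⇒0 (trans (sym (∑q-+ (λ x → x) (λ _ → 1#)))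
    (∑q-permute (λ x → x) (_+ 1#) (_- 1#) (λ x x∈ → Fq-+ x∈ (1^n≡1 q)) (λ x x∈ → Fq-- x∈ (1^n≡1 q))
      (λ x _ → shift-back x 1#) (λ x _ → shift-forth x 1#)))

  -- On F_q, x^m is 1 minus the indicator of 0; at 0 this uses 1 ≤ m.
  ∑q-x^m : ∑q (λ x → x ^ m) ≡ - 1#
  ∑q-x^m = begin
    ∑q (λ x → x ^ m)                                                 ≡⟨ ∑q-cong pointwise ⟩
    ∑q (λ x → 1# + (if does (x ≟ 0#) then - 1# else 0#))             ≡⟨ ∑q-+ (λ _ → 1#) _ ⟩
    ∑q (λ _ → 1#) + ∑q (λ x → if does (x ≟ 0#) then - 1# else 0#)    ≡⟨ cong₂ _+_ ∑q-1 (∑q-at-0 (- 1#)) ⟩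
    0# + - 1#                                                        ≡⟨ +-identityˡ _ ⟩
    - 1#                                                             ∎
    where
    0^ : ∀ {n} → 1 ℕ.≤ n → 0# ^ n ≡ 0#
    0^ (s≤s _) = zeroˡ _
    pointwise : ∀ x → Fq x → x ^ m ≡ 1# + (if does (x ≟ 0#) then - 1# else 0#)
    pointwise x x∈ with x ≟ 0#
    ... | yes refl = trans (0^ 1≤m) (sym (-‿inverseʳ 1#))
    ... | no x≢0   = trans (Fq-^m x≢0 x∈) (sym (+-identityʳ 1#))

  u : Carrier → Carrier
  u x = x ^ q - x

  -- The cofactor of X^q - X in X^(q³) - X: with U = X^q - X, the latter is U + U^q + U^(q²).
  H : Carrier → Carrier
  H x = (u x ^ (m ℕ.+ m ℕ.* q) + u x ^ m) + 1#

  -- The Frobenius powers of U telescope to x^(q³) - x = 0. The exponents `m + m * q` and `m` are q²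
  -- - 1 and q - 1, in a form whose successors reduce to `q * q` and `q`.
  u*H≡0 : ∀ x → u x * H x ≡ 0#
  u*H≡0 x = begin
    u x * H x                            ≡⟨ solve 3 (λ u a b → u :* ((a :+ b) :+ :1) := (u :* a :+ u :* b) :+ u) refl (u x) _ _ ⟩
    (u x ^ (q ℕ.* q) + u x ^ q) + u x    ≡⟨ cong (λ z → (z + u x ^ q) + u x) (sym (^-* (u x) q q)) ⟩
    ((u x ^ q) ^ q + u x ^ q) + u x      ≡⟨ cong (λ z → (z ^ q + z) + u x) (frobenius-- (x ^ q) x) ⟩
    ((x₂ - x₁) ^ q + (x₂ - x₁)) + u x    ≡⟨ cong (λ z → (z + (x₂ - x₁)) + u x) (trans (frobenius-- x₂ x₁) (cong (_- x₂) (frobenius³ x))) ⟩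
    ((x - x₂) + (x₂ - x₁)) + (x₁ - x)    ≡⟨ solve 3 (λ x y z → ((x :- z) :+ (z :- y)) :+ (y :- x) := :0) refl x x₁ x₂ ⟩
    0#                                   ∎
    where
    x₁ = x ^ q
    x₂ = x₁ ^ q

  monic-u : Monic q u
  monic-u = monic-resp (λ x → cong (x ^ q +_) (solve 1 (λ x → :- x := :- :1 :* (x :* :1)) refl x))
    (monic-+ (monic-x^ q) (degLess-mono (s≤s 1≤m) (degLess-*ˡ (- 1#) (monic⇒degLess (monic-x^ 1)))))

  -- The degree is (q² - 1) q = q³ - q.
  monic-H : Monic ((m ℕ.+ m ℕ.* q) ℕ.* q) H
  monic-H = monic-+ (monic-+ (monic-^ (m ℕ.+ m ℕ.* q) monic-u)
    (degLess-mono bound (monic⇒degLess (monic-^ m monic-u))))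
    (degLess-mono (ℕ.≤-trans (s≤s z≤n) bound) (degLess-const 1#))
    where
    bound : suc (m ℕ.* q) ℕ.≤ (m ℕ.+ m ℕ.* q) ℕ.* q
    bound = ℕ.≤-trans (ℕ.+-monoˡ-≤ (m ℕ.* q) 1≤m) (ℕ.m≤m*n (m ℕ.+ m ℕ.* q) q)

  x^j≡1⇒m≤j : ∀ j → 1 ℕ.≤ j → (∀ x → Fq x → x ≢ 0# → x ^ j ≡ 1#) → m ℕ.≤ j
  x^j≡1⇒m≤j j 1≤j x^j≡1 = ℕ.≮⇒≥ (λ j<m → ℕ.<⇒≱ (degree<N j<m)
    (monic-roots≤degree monic-W (Inverse.from enumeration) ∑.from-injective (λ i → W≡0 (Inverse.from enumeration i))))
    where
    W : Carrier → Carrier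
    W x = (x * (x ^ j - 1#)) * H x
    monic-W : Monic (suc j ℕ.+ (m ℕ.+ m ℕ.* q) ℕ.* q) W
    monic-W = monic-* (monic-x* (monic-+ (monic-x^ j) (degLess-mono 1≤j (degLess-const (- 1#))))) monic-H
    W≡0 : ∀ x → W x ≡ 0#
    W≡0 x with Fq? x
    ... | no x∉ = trans (cong ((x * (x ^ j - 1#)) *_) (x*y≡0⇒y≡0 (H x) (x≢y⇒x-y≢0 x∉) (u*H≡0 x))) (zeroʳ _)
    ... | yes x∈ with x ≟ 0#
    ...   | yes refl = trans (cong (_* H 0#) (zeroˡ _)) (zeroˡ _)
    ...   | no x≢0   = trans (cong (λ z → (x * (z - 1#)) * H x) (x^j≡1 x x∈ x≢0))
      (solve 2 (λ x h → (x :* (:1 :- :1)) :* h := :0) refl x (H x))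
    -- `q * q * q` reduces to `q + (m + m * q) * q`, so only `suc j < q` has to be shown.
    degree<N : j ℕ.< m → suc j ℕ.+ (m ℕ.+ m ℕ.* q) ℕ.* q ℕ.< N
    degree<N j<m = ℕ.<-≤-trans (ℕ.+-monoˡ-< ((m ℕ.+ m ℕ.* q) ℕ.* q) (s≤s j<m))
      (ℕ.≤-reflexive (sym (trans N≡q³ (trans (sym (ℕ.*-assoc q q (q ℕ.* 1))) (cong (q ℕ.* q ℕ.*_) (ℕ.*-identityʳ q))))))

  -- For x in F_q^* the map y ↦ x y permutes F_q, so x^j S = S, and S ≠ 0 would give x^j = 1. The
  -- exponent 0 is apart because X^0 - 1 is the zero polynomial.
  ∑q-x^j : ∀ j → j ℕ.< m → ∑q (λ x → x ^ j) ≡ 0#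
  ∑q-x^j zero      _   = ∑q-1
  ∑q-x^j j@(suc _) j<m = decidable-stable (∑q (λ x → x ^ j) ≟ 0#) (λ S≢0 →
    ℕ.<⇒≱ j<m (x^j≡1⇒m≤j j (s≤s z≤n) (λ x x∈ x≢0 → *-cancelˡ _ _ S≢0 (begin
      ∑q (λ y → y ^ j) * x ^ j      ≡⟨ *-comm _ _ ⟩
      x ^ j * ∑q (λ y → y ^ j)      ≡⟨ sym (∑q-* (x ^ j) (λ y → y ^ j)) ⟩
      ∑q (λ y → x ^ j * y ^ j)      ≡⟨ ∑q-cong (λ y _ → sym (^-distrib-* x y j)) ⟩
      ∑q (λ y → (x * y) ^ j)        ≡⟨ ∑q-permute (_^ j) (x *_) (x ⁻¹ *_) (λ _ → Fq-* x∈) (λ _ → Fq-* (Fq-⁻¹ x≢0 x∈))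
                                         (λ y _ → inverseˡ x≢0 y) (λ y _ → inverseˡ′ x≢0 y) ⟩
      ∑q (λ y → y ^ j)              ≡⟨ sym (*-identityʳ _) ⟩
      ∑q (λ y → y ^ j) * 1#         ∎))))

  -- Each Horner step releases a term c x^k with k < m, whose sum vanishes. Only the leading term
  -- survives, and its exponent may equal m.
  ∑q-x^k*monic : ∀ {d f} k → Monic d f → d ℕ.+ k ℕ.≤ m → ∑q (λ x → x ^ k * f x) ≡ ∑q (λ x → x ^ (d ℕ.+ k))
  ∑q-x^k*monic k (one f≡1) _ = ∑q-cong (λ x _ → trans (cong (x ^ k *_) (f≡1 x)) (*-identityʳ _))
  ∑q-x^k*monic {suc d} {f} k (horner {g = g} c mg eq) d+k≤m = begin
    ∑q (λ x → x ^ k * f x)                             ≡⟨ ∑q-cong (λ x _ → trans (cong (x ^ k *_) (eq x))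
      (solve 4 (λ c x a g → a :* (c :+ x :* g) := c :* a :+ (x :* a) :* g) refl c x (x ^ k) (g x))) ⟩
    ∑q (λ x → c * x ^ k + x ^ suc k * g x)             ≡⟨ ∑q-+ (λ x → c * x ^ k) (λ x → x ^ suc k * g x) ⟩
    ∑q (λ x → c * x ^ k) + ∑q (λ x → x ^ suc k * g x)  ≡⟨ cong₂ _+_ (trans (∑q-* c (_^ k)) (cong (c *_) (∑q-x^j k (ℕ.≤-trans (s≤s (ℕ.m≤n+m k d)) d+k≤m))))
                                                            (∑q-x^k*monic (suc k) mg (ℕ.≤-trans (ℕ.≤-reflexive (ℕ.+-suc d k)) d+k≤m)) ⟩
    c * 0# + ∑q (λ x → x ^ (d ℕ.+ suc k))              ≡⟨ trans (cong (_+ ∑q (λ x → x ^ (d ℕ.+ suc k))) (zeroʳ c)) (+-identityˡ _) ⟩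
    ∑q (λ x → x ^ (d ℕ.+ suc k))                       ≡⟨ cong (λ n → ∑q (λ x → x ^ n)) (ℕ.+-suc d k) ⟩
    ∑q (λ x → x ^ suc (d ℕ.+ k))                       ∎

  -- For r outside F_q, x ↦ x - r does not preserve F_q; what counts is that (x - r)^j is monic of
  -- degree j ≤ m.
  ∑q-[x-r]^j : ∀ r j → j ℕ.≤ m → ∑q (λ x → (x - r) ^ j) ≡ ∑q (λ x → x ^ j)
  ∑q-[x-r]^j r j j≤m = begin
    ∑q (λ x → (x - r) ^ j)         ≡⟨ ∑q-cong (λ x _ → sym (*-identityˡ _)) ⟩
    ∑q (λ x → 1# * (x - r) ^ j)    ≡⟨ ∑q-x^k*monic 0 monic-[x-r]^j (ℕ.≤-trans (ℕ.≤-reflexive (ℕ.+-identityʳ j)) j≤m) ⟩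
    ∑q (λ x → x ^ (j ℕ.+ 0))       ≡⟨ cong (λ n → ∑q (λ x → x ^ n)) (ℕ.+-identityʳ j) ⟩
    ∑q (λ x → x ^ j)               ∎
    where
    monic-[x-r]^j : Monic j (λ x → (x - r) ^ j)
    monic-[x-r]^j = subst (λ n → Monic n (λ x → (x - r) ^ j)) (ℕ.*-identityʳ j)
      (monic-^ j (horner (- r) (one (λ _ → refl)) (λ x → solve 2 (λ x r → x :- r := :- r :+ x :* :1) refl x r)))

  -- Carlitz's formula for sums of powers of 1/(x - r)

  module Carlitz {r : Carrier} (r∉ : ¬ Fq r) where
    t : Carrier
    t = r ^ q - r

    t≢0 : t ≢ 0#
    t≢0 = x≢y⇒x-y≢0 r∉

    x-r≢0 : ∀ {x} → Fq x → x - r ≢ 0#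
    x-r≢0 x∈ = x≢y⇒x-y≢0 (λ { refl → r∉ x∈ })

    y : Carrier → Carrier
    y x = (x - r) ⁻¹

    -- From (x - r)^q = x - r^q = (x - r) - t, divided by x - r.
    t*y : ∀ x → Fq x → t * y x ≡ 1# - (x - r) ^ m
    t*y x x∈ = *-cancelˡ _ _ (x-r≢0 x∈) (begin
      (x - r) * (t * y x)                ≡⟨ solve 3 (λ d t y → d :* (t :* y) := t :* (d :* y)) refl (x - r) t (y x) ⟩
      t * ((x - r) * y x)                ≡⟨ cong (t *_) (inverseʳ _ (x-r≢0 x∈)) ⟩
      t * 1#                             ≡⟨ solve 3 (λ x r s → (s :- r) :* :1 := (x :- r) :- (x :- s)) refl x r (r ^ q) ⟩
      (x - r) - (x - r ^ q)              ≡⟨ cong (λ z → (x - r) - (z - r ^ q)) (sym x∈) ⟩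
      (x - r) - (x ^ q - r ^ q)          ≡⟨ cong (λ z → (x - r) - z) (sym (frobenius-- x r)) ⟩
      (x - r) - (x - r) ^ q              ≡⟨ solve 2 (λ d e → d :- d :* e := d :* (:1 :- e)) refl (x - r) ((x - r) ^ m) ⟩
      (x - r) * (1# - (x - r) ^ m)       ∎)

    y^k*[x-r]^m : ∀ k → k ℕ.≤ m → ∀ x → Fq x → y x ^ k * (x - r) ^ m ≡ (x - r) ^ (m ℕ.∸ k)
    y^k*[x-r]^m k k≤m x x∈ = begin
      y x ^ k * (x - r) ^ m                            ≡⟨ cong (λ n → y x ^ k * (x - r) ^ n) (sym (ℕ.m+[n∸m]≡n k≤m)) ⟩
      y x ^ k * (x - r) ^ (k ℕ.+ (m ℕ.∸ k))            ≡⟨ cong (y x ^ k *_) (^-homo-+ (x - r) k (m ℕ.∸ k)) ⟩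
      y x ^ k * ((x - r) ^ k * (x - r) ^ (m ℕ.∸ k))    ≡⟨ solve 3 (λ a b c → a :* (b :* c) := (b :* a) :* c) refl (y x ^ k) ((x - r) ^ k) _ ⟩
      ((x - r) ^ k * y x ^ k) * (x - r) ^ (m ℕ.∸ k)    ≡⟨ cong (_* (x - r) ^ (m ℕ.∸ k)) (sym (^-distrib-* (x - r) (y x) k)) ⟩
      ((x - r) * y x) ^ k * (x - r) ^ (m ℕ.∸ k)        ≡⟨ cong (λ z → z ^ k * (x - r) ^ (m ℕ.∸ k)) (inverseʳ _ (x-r≢0 x∈)) ⟩
      1# ^ k * (x - r) ^ (m ℕ.∸ k)                     ≡⟨ trans (cong (_* (x - r) ^ (m ℕ.∸ k)) (1^n≡1 k)) (*-identityˡ _) ⟩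
      (x - r) ^ (m ℕ.∸ k)                              ∎

    -- Multiplying `t*y` by y^k and summing gives a recursion in k whose other term is a known power
    -- sum.
    t*∑q-y^ : ∀ k → k ℕ.≤ m →
              t * ∑q (λ x → y x ^ suc k) ≡ ∑q (λ x → y x ^ k) + - 1# * ∑q (λ x → x ^ (m ℕ.∸ k))
    t*∑q-y^ k k≤m = begin
      t * ∑q (λ x → y x ^ suc k)                                        ≡⟨ sym (∑q-* t _) ⟩
      ∑q (λ x → t * y x ^ suc k)                                        ≡⟨ ∑q-cong pointwise ⟩
      ∑q (λ x → y x ^ k + - 1# * (x - r) ^ (m ℕ.∸ k))                   ≡⟨ trans (∑q-+ _ _) (cong (λ z → ∑q (λ x → y x ^ k) + z) (∑q-* (- 1#) _)) ⟩
      ∑q (λ x → y x ^ k) + - 1# * ∑q (λ x → (x - r) ^ (m ℕ.∸ k))        ≡⟨ cong (λ z → ∑q (λ x → y x ^ k) + - 1# * z) (∑q-[x-r]^j r (m ℕ.∸ k) (ℕ.m∸n≤m m k)) ⟩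
      ∑q (λ x → y x ^ k) + - 1# * ∑q (λ x → x ^ (m ℕ.∸ k))              ∎
      where
      pointwise : ∀ x → Fq x → t * y x ^ suc k ≡ y x ^ k + - 1# * (x - r) ^ (m ℕ.∸ k)
      pointwise x x∈ = begin
        t * (y x * y x ^ k)                        ≡⟨ sym (*-assoc t (y x) (y x ^ k)) ⟩
        (t * y x) * y x ^ k                        ≡⟨ cong (_* y x ^ k) (t*y x x∈) ⟩
        (1# - (x - r) ^ m) * y x ^ k               ≡⟨ solve 2 (λ a b → (:1 :- a) :* b := b :+ :- :1 :* (b :* a)) refl ((x - r) ^ m) (y x ^ k) ⟩
        y x ^ k + - 1# * (y x ^ k * (x - r) ^ m)   ≡⟨ cong (λ z → y x ^ k + - 1# * z) (y^k*[x-r]^m k k≤m x x∈) ⟩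
        y x ^ k + - 1# * (x - r) ^ (m ℕ.∸ k)       ∎

    -- The power sum contributes only at k = 0, where it is -1; later its exponent is below m and
    -- each step divides by t. The shifted index makes `k ≤ m` cover the exponents 1 to q.
    ∑q-y^ : ∀ k → k ℕ.≤ m → ∑q (λ x → y x ^ suc k) ≡ (t ⁻¹) ^ suc k
    ∑q-y^ zero k≤m = *-cancelˡ _ _ t≢0 (begin
      t * ∑q (λ x → y x ^ 1)                           ≡⟨ t*∑q-y^ 0 z≤n ⟩
      ∑q (λ x → 1#) + - 1# * ∑q (λ x → x ^ m)          ≡⟨ cong₂ (λ a b → a + - 1# * b) ∑q-1 ∑q-x^m ⟩
      0# + - 1# * - 1#                                 ≡⟨ solve 0 (:0 :+ :- :1 :* :- :1 := :1) refl ⟩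
      1#                                               ≡⟨ sym (inverseʳ t t≢0) ⟩
      t * t ⁻¹                                         ≡⟨ cong (t *_) (sym (*-identityʳ _)) ⟩
      t * (t ⁻¹) ^ 1                                   ∎)
    ∑q-y^ (suc k) k<m = *-cancelˡ _ _ t≢0 (begin
      t * ∑q (λ x → y x ^ suc (suc k))                                    ≡⟨ t*∑q-y^ (suc k) k<m ⟩
      ∑q (λ x → y x ^ suc k) + - 1# * ∑q (λ x → x ^ (m ℕ.∸ suc k))        ≡⟨ cong₂ (λ a b → a + - 1# * b) (∑q-y^ k (ℕ.<⇒≤ k<m)) (∑q-x^j _ (ℕ.∸-monoʳ-< {m} (s≤s z≤n) k<m)) ⟩
      (t ⁻¹) ^ suc k + - 1# * 0#                                          ≡⟨ solve 1 (λ a → a :+ :- :1 :* :0 := a) refl _ ⟩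
      (t ⁻¹) ^ suc k                                                      ≡⟨ sym (inverseˡ t≢0 _) ⟩
      t * (t ⁻¹) ^ suc (suc k)                                            ∎)

-- Identities behind the expansions of f² and f³

module Identities (K : Field) where
  open Field K
  open FieldProperties K
  open ≡-Reasoning

  two : Carrier
  two = 1# + 1#

  -- Multiply s - r = (x - r) - (x - s) by i y z. The ring solver does not know `⁻¹`, so inverses
  -- are variables with a defining equation, here and below.
  partial-fraction : ∀ {x r s y z i} → (x - r) * y ≡ 1# → (x - s) * z ≡ 1# → (s - r) * i ≡ 1# →
                     y * z ≡ i * (z - y)
  partial-fraction {x} {r} {s} {y} {z} {i} y⁻¹ z⁻¹ i⁻¹ = begin
    y * z                                            ≡⟨ sym (*-identityˡ _) ⟩
    1# * (y * z)                                     ≡⟨ cong (_* (y * z)) (sym i⁻¹) ⟩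
    ((s - r) * i) * (y * z)                          ≡⟨ solve 6 (λ x r s y z i → ((s :- r) :* i) :* (y :* z) :=
                                                          i :* (((x :- r) :* y) :* z :- ((x :- s) :* z) :* y)) refl x r s y z i ⟩
    i * (((x - r) * y) * z - ((x - s) * z) * y)      ≡⟨ cong₂ (λ b c → i * (b * z - c * y)) y⁻¹ z⁻¹ ⟩
    i * (1# * z - 1# * y)                            ≡⟨ cong₂ (λ b c → i * (b - c)) (*-identityˡ z) (*-identityˡ y) ⟩
    i * (z - y)                                      ∎

  partial-fraction-y : ∀ {y z i} → y * z ≡ i * (z - y) → (y * z) * y ≡ i * (i * (z - y) - y ^ 2)
  partial-fraction-y {y} {z} {i} yz = begin
    (y * z) * y                   ≡⟨ cong (_* y) yz ⟩
    (i * (z - y)) * y             ≡⟨ solve 3 (λ y z i → (i :* (z :- y)) :* y := i :* (y :* z :- y :^ 2)) refl y z i ⟩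
    i * (y * z - y ^ 2)           ≡⟨ cong (λ w → i * (w - y ^ 2)) yz ⟩
    i * (i * (z - y) - y ^ 2)     ∎

  partial-fraction-z : ∀ {y z i} → y * z ≡ i * (z - y) → (y * z) * z ≡ i * (z ^ 2 - i * (z - y))
  partial-fraction-z {y} {z} {i} yz = begin
    (y * z) * z                   ≡⟨ cong (_* z) yz ⟩
    (i * (z - y)) * z             ≡⟨ solve 3 (λ y z i → (i :* (z :- y)) :* z := i :* (z :^ 2 :- y :* z)) refl y z i ⟩
    i * (z ^ 2 - y * z)           ≡⟨ cong (λ w → i * (z ^ 2 - w)) yz ⟩
    i * (z ^ 2 - i * (z - y))     ∎

  x*y≡1+r*y : ∀ {x r y} → (x - r) * y ≡ 1# → x * y ≡ 1# + r * y
  x*y≡1+r*y {x} {r} {y} y⁻¹ = trans (solve 3 (λ x r y → x :* y := (x :- r) :* y :+ r :* y) refl x r y) (cong (_+ r * y) y⁻¹)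

  -- The mixed products are left as parameters, to be replaced by linear combinations of powers of x
  -- and of single fractions, whose sums are known.
  square-expansion : ∀ a x y₁ y₂ y₃ {p₁ p₂ p₃ z₁ z₂ z₃} →
    x * y₁ ≡ p₁ → x * y₂ ≡ p₂ → x * y₃ ≡ p₃ → y₁ * y₂ ≡ z₁ → y₂ * y₃ ≡ z₂ → y₃ * y₁ ≡ z₃ →
    (a * x + y₁ + y₂ + y₃) ^ 2 ≡
      (a ^ 2 * x ^ 2 + (two * a) * (p₁ + p₂ + p₃)) + ((y₁ ^ 2 + y₂ ^ 2 + y₃ ^ 2) + two * (z₁ + z₂ + z₃))
  square-expansion a x y₁ y₂ y₃ refl refl refl refl refl refl = solve 5 (λ a x y₁ y₂ y₃ →
    (a :* x :+ y₁ :+ y₂ :+ y₃) :^ 2 :=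
      (a :^ 2 :* x :^ 2 :+ ((:1 :+ :1) :* a) :* (x :* y₁ :+ x :* y₂ :+ x :* y₃)) :+
      ((y₁ :^ 2 :+ y₂ :^ 2 :+ y₃ :^ 2) :+ (:1 :+ :1) :* (y₁ :* y₂ :+ y₂ :* y₃ :+ y₃ :* y₁))) refl a x y₁ y₂ y₃

  two*-vanish : ∀ x {y} → two ≡ 0# → x + two * y ≡ x
  two*-vanish x {y} 2≡0 = trans (cong (λ z → x + z * y) 2≡0) (solve 2 (λ x y → x :+ :0 :* y := x) refl x y)

  -- Modulo 2 the multinomial coefficients 3 become 1 and the coefficients 6 vanish, so no product
  -- of three distinct summands remains.
  cube-expansion : ∀ a x y₁ y₂ y₃ {p₁ p₂ p₃ s₁ s₂ s₃ z₁ z₂ z₃ w₁ w₂ w₃} → two ≡ 0# →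
    x * (x * y₁) ≡ p₁ → x * (x * y₂) ≡ p₂ → x * (x * y₃) ≡ p₃ →
    (x * y₁) * y₁ ≡ s₁ → (x * y₂) * y₂ ≡ s₂ → (x * y₃) * y₃ ≡ s₃ →
    (y₁ * y₂) * y₁ ≡ z₁ → (y₂ * y₃) * y₂ ≡ z₂ → (y₃ * y₁) * y₃ ≡ z₃ →
    (y₁ * y₂) * y₂ ≡ w₁ → (y₂ * y₃) * y₃ ≡ w₂ → (y₃ * y₁) * y₁ ≡ w₃ →
    (a * x + y₁ + y₂ + y₃) ^ 3 ≡
      (a ^ 3 * x ^ 3 + (a ^ 2 * (p₁ + p₂ + p₃) + a * (s₁ + s₂ + s₃))) +
      ((y₁ ^ 3 + y₂ ^ 3 + y₃ ^ 3) + ((z₁ + z₂ + z₃) + (w₁ + w₂ + w₃)))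
  cube-expansion a x y₁ y₂ y₃ 2≡0 refl refl refl refl refl refl refl refl refl refl refl refl =
    trans (solve 5 (λ a x y₁ y₂ y₃ →
      let z = (y₁ :* y₂) :* y₁ :+ (y₂ :* y₃) :* y₂ :+ (y₃ :* y₁) :* y₃
          w = (y₁ :* y₂) :* y₂ :+ (y₂ :* y₃) :* y₃ :+ (y₃ :* y₁) :* y₁
          p = x :* (x :* y₁) :+ x :* (x :* y₂) :+ x :* (x :* y₃)
          s = (x :* y₁) :* y₁ :+ (x :* y₂) :* y₂ :+ (x :* y₃) :* y₃
          three = :1 :+ :1 :+ :1
      in (a :* x :+ y₁ :+ y₂ :+ y₃) :^ 3 :=
        ((a :^ 3 :* x :^ 3 :+ (a :^ 2 :* p :+ a :* s)) :+ ((y₁ :^ 3 :+ y₂ :^ 3 :+ y₃ :^ 3) :+ (z :+ w))) :+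
        (:1 :+ :1) :* (a :^ 2 :* p :+ a :* s :+ (z :+ w) :+ three :* (a :* x :* (y₁ :* y₂ :+ y₂ :* y₃ :+ y₃ :* y₁) :+ y₁ :* y₂ :* y₃)))
      refl a x y₁ y₂ y₃)
    (two*-vanish _ 2≡0)

  -- This is t₁ t₂ t₃ times the sum of the inverses.
  pairwise-products : ∀ {t₁ t₂ t₃ i₁ i₂ i₃} → t₁ * i₁ ≡ 1# → t₂ * i₂ ≡ 1# → t₃ * i₃ ≡ 1# →
                      i₁ + i₂ + i₃ ≡ 0# → t₁ * t₂ + t₂ * t₃ + t₃ * t₁ ≡ 0#
  pairwise-products {t₁} {t₂} {t₃} {i₁} {i₂} {i₃} e₁ e₂ e₃ ∑i≡0 = begin
    t₁ * t₂ + t₂ * t₃ + t₃ * t₁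
      ≡⟨ solve 3 (λ t₁ t₂ t₃ → t₁ :* t₂ :+ t₂ :* t₃ :+ t₃ :* t₁ := :1 :* (t₂ :* t₃) :+ :1 :* (t₁ :* t₃) :+ :1 :* (t₁ :* t₂)) refl t₁ t₂ t₃ ⟩
    1# * (t₂ * t₃) + 1# * (t₁ * t₃) + 1# * (t₁ * t₂)
      ≡⟨ cong₂ _+_ (cong₂ (λ b c → b * (t₂ * t₃) + c * (t₁ * t₃)) (sym e₁) (sym e₂)) (cong (_* (t₁ * t₂)) (sym e₃)) ⟩
    (t₁ * i₁) * (t₂ * t₃) + (t₂ * i₂) * (t₁ * t₃) + (t₃ * i₃) * (t₁ * t₂)
      ≡⟨ solve 6 (λ t₁ t₂ t₃ i₁ i₂ i₃ → (t₁ :* i₁) :* (t₂ :* t₃) :+ (t₂ :* i₂) :* (t₁ :* t₃) :+ (t₃ :* i₃) :* (t₁ :* t₂)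
           := (t₁ :* t₂ :* t₃) :* (i₁ :+ i₂ :+ i₃)) refl t₁ t₂ t₃ i₁ i₂ i₃ ⟩
    (t₁ * t₂ * t₃) * (i₁ + i₂ + i₃)
      ≡⟨ trans (cong ((t₁ * t₂ * t₃) *_) ∑i≡0) (zeroʳ _) ⟩
    0# ∎

  module CubeRoot {t₁ t₂ t₃ i₁ i₂ i₃}
    (e₁ : t₁ * i₁ ≡ 1#) (e₂ : t₂ * i₂ ≡ 1#) (e₃ : t₃ * i₃ ≡ 1#)
    (∑t≡0 : t₁ + t₂ + t₃ ≡ 0#) (∑i≡0 : i₁ + i₂ + i₃ ≡ 0#) where

    ω : Carrier
    ω = i₁ * t₂

    -- t₁² + t₁ t₂ + t₂² equals (t₁ + t₂) ∑ tₖ minus the sum of pairwise products, so it vanishes;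
    -- divide by t₁².
    1+ω+ω²≡0 : 1# + ω + ω * ω ≡ 0#
    1+ω+ω²≡0 = begin
      1# + ω + ω * ω
        ≡⟨ solve 2 (λ i₁ t₂ → :1 :+ i₁ :* t₂ :+ (i₁ :* t₂) :* (i₁ :* t₂) := :1 :* :1 :+ :1 :* (i₁ :* t₂) :+ (i₁ :* t₂) :* (i₁ :* t₂)) refl i₁ t₂ ⟩
      1# * 1# + 1# * ω + ω * ω
        ≡⟨ cong (λ b → b * b + b * ω + ω * ω) (sym e₁) ⟩
      (t₁ * i₁) * (t₁ * i₁) + (t₁ * i₁) * ω + ω * ω
        ≡⟨ solve 4 (λ t₁ t₂ t₃ i₁ → (t₁ :* i₁) :* (t₁ :* i₁) :+ (t₁ :* i₁) :* (i₁ :* t₂) :+ (i₁ :* t₂) :* (i₁ :* t₂)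
             := (i₁ :* i₁) :* ((t₁ :+ t₂) :* (t₁ :+ t₂ :+ t₃) :- (t₁ :* t₂ :+ t₂ :* t₃ :+ t₃ :* t₁))) refl t₁ t₂ t₃ i₁ ⟩
      (i₁ * i₁) * ((t₁ + t₂) * (t₁ + t₂ + t₃) - (t₁ * t₂ + t₂ * t₃ + t₃ * t₁))
        ≡⟨ cong₂ (λ b c → (i₁ * i₁) * ((t₁ + t₂) * b - c)) ∑t≡0 (pairwise-products e₁ e₂ e₃ ∑i≡0) ⟩
      (i₁ * i₁) * ((t₁ + t₂) * 0# - 0#)
        ≡⟨ solve 2 (λ i t → (i :* i) :* (t :* :0 :- :0) := :0) refl i₁ (t₁ + t₂) ⟩
      0# ∎

    t₂≡ω*t₁ : t₂ ≡ ω * t₁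
    t₂≡ω*t₁ = begin
      t₂                ≡⟨ sym (*-identityˡ t₂) ⟩
      1# * t₂           ≡⟨ cong (_* t₂) (sym e₁) ⟩
      (t₁ * i₁) * t₂    ≡⟨ solve 3 (λ t₁ i₁ t₂ → (t₁ :* i₁) :* t₂ := (i₁ :* t₂) :* t₁) refl t₁ i₁ t₂ ⟩
      ω * t₁            ∎

    -- ω³ = 1 by 1 - ω³ = (1 - ω)(1 + ω + ω²), and ω i₂ = i₁ t₂ i₂ = i₁.
    i₂≡ω²*i₁ : i₂ ≡ (ω * ω) * i₁
    i₂≡ω²*i₁ = begin
      i₂                                                          ≡⟨ solve 2 (λ ω i → i := ((ω :* ω) :* ω) :* i :+ ((:1 :- ω) :* i) :* (:1 :+ ω :+ ω :* ω)) refl ω i₂ ⟩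
      ((ω * ω) * ω) * i₂ + ((1# - ω) * i₂) * (1# + ω + ω * ω)     ≡⟨ cong (λ e → ((ω * ω) * ω) * i₂ + ((1# - ω) * i₂) * e) 1+ω+ω²≡0 ⟩
      ((ω * ω) * ω) * i₂ + ((1# - ω) * i₂) * 0#                   ≡⟨ solve 4 (λ w c i₁ t₂ → (w :* (i₁ :* t₂)) :* c :+ ((:1 :- (i₁ :* t₂)) :* c) :* :0
                                                                         := (w :* i₁) :* (t₂ :* c)) refl (ω * ω) i₂ i₁ t₂ ⟩
      ((ω * ω) * i₁) * (t₂ * i₂)                                  ≡⟨ trans (cong (((ω * ω) * i₁) *_) e₂) (*-identityʳ _) ⟩
      (ω * ω) * i₁                                                ∎

    -- i₃ = -(i₁ + i₂) = -(1 + ω²) i₁ = ω i₁.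
    i₃≡ω*i₁ : i₃ ≡ ω * i₁
    i₃≡ω*i₁ = begin
      i₃                                                          ≡⟨ solve 4 (λ ω i₁ i₂ i₃ → i₃ := (ω :* i₁ :+ (i₁ :+ i₂ :+ i₃) :- (i₂ :- (ω :* ω) :* i₁)) :- i₁ :* (:1 :+ ω :+ ω :* ω)) refl ω i₁ i₂ i₃ ⟩
      (ω * i₁ + (i₁ + i₂ + i₃) - (i₂ - (ω * ω) * i₁)) - i₁ * (1# + ω + ω * ω)
        ≡⟨ cong₂ (λ b e → (ω * i₁ + b - (i₂ - (ω * ω) * i₁)) - i₁ * e) ∑i≡0 1+ω+ω²≡0 ⟩
      (ω * i₁ + 0# - (i₂ - (ω * ω) * i₁)) - i₁ * 0#               ≡⟨ cong (λ b → (ω * i₁ + 0# - (b - (ω * ω) * i₁)) - i₁ * 0#) i₂≡ω²*i₁ ⟩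
      (ω * i₁ + 0# - ((ω * ω) * i₁ - (ω * ω) * i₁)) - i₁ * 0#     ≡⟨ solve 2 (λ ω i → (ω :* i :+ :0 :- ((ω :* ω) :* i :- (ω :* ω) :* i)) :- i :* :0 := ω :* i) refl ω i₁ ⟩
      ω * i₁                                                      ∎

    ω≢0 : ω ≢ 0#
    ω≢0 ω≡0 = 0≢1 (begin
      0#                  ≡⟨ sym 1+ω+ω²≡0 ⟩
      1# + ω + ω * ω      ≡⟨ cong (λ w → 1# + w + w * w) ω≡0 ⟩
      1# + 0# + 0# * 0#   ≡⟨ solve 0 (:1 :+ :0 :+ :0 :* :0 := :1) refl ⟩
      1#                  ∎)

    -- 3 is the resultant of X² - 1 and X² + X + 1; the first step is the Bézout identity that
    -- expresses it.
    ω²-1≢0 : 1# + 1# + 1# ≢ 0# → ω * ω - 1# ≢ 0#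
    ω²-1≢0 3≢0 ω²-1≡0 = 3≢0 (begin
      1# + 1# + 1#                                                        ≡⟨ solve 1 (λ ω → :1 :+ :1 :+ :1 := (ω :* ω :- :1) :* (ω :- :1) :- (:1 :+ ω :+ ω :* ω) :* (ω :- :1 :- :1)) refl ω ⟩
      (ω * ω - 1#) * (ω - 1#) - (1# + ω + ω * ω) * (ω - 1# - 1#)          ≡⟨ cong₂ (λ b e → b * (ω - 1#) - e * (ω - 1# - 1#)) ω²-1≡0 1+ω+ω²≡0 ⟩
      0# * (ω - 1#) - 0# * (ω - 1# - 1#)                                  ≡⟨ solve 1 (λ ω → :0 :* (ω :- :1) :- :0 :* (ω :- :1 :- :1) := :0) refl ω ⟩
      0#                                                                  ∎)

  -- The left side is the unsimplified sum of f², each `0#` being a vanishing power sum of x. Modulo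
  -- 1 + ω + ω² both ∑ iₖ² and the pairwise terms vanish, and ∑ rₖ iₖ becomes t i (2ω² + ω) = ω² -
  -- 1.
  square-value : ∀ a r t ω i {r₂ r₃ i₂ i₃} → t * i ≡ 1# → 1# + ω + ω * ω ≡ 0# →
    r₂ ≡ r + t → r₃ ≡ r + t + ω * t → i₂ ≡ (ω * ω) * i → i₃ ≡ ω * i →
    (a ^ 2 * 0# + (two * a) * ((0# + r * i) + (0# + r₂ * i₂) + (0# + r₃ * i₃))) +
      ((i ^ 2 + i₂ ^ 2 + i₃ ^ 2) + two * (i * (i₂ - i) + i₂ * (i₃ - i₂) + i₃ * (i - i₃))) ≡ (two * a) * (ω * ω - 1#)
  square-value a r t ω i ti≡1 e≡0 refl refl refl refl = begin
    _ ≡⟨ solve 5 (λ a r t ω i →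
           let r₂ = r :+ t
               r₃ = r :+ t :+ ω :* t
               i₂ = (ω :* ω) :* i
               i₃ = ω :* i
               :2 = :1 :+ :1
           in (a :^ 2 :* :0 :+ (:2 :* a) :* ((:0 :+ r :* i) :+ (:0 :+ r₂ :* i₂) :+ (:0 :+ r₃ :* i₃))) :+
             ((i :^ 2 :+ i₂ :^ 2 :+ i₃ :^ 2) :+ :2 :* (i :* (i₂ :- i) :+ i₂ :* (i₃ :- i₂) :+ i₃ :* (i :- i₃)))
           := (:2 :* a) :* ((t :* i) :* (ω :* ω :- :1)) :+ (:1 :+ ω :+ ω :* ω) :*
             ((:2 :* a) :* (r :* i :+ t :* i) :+ (i :* i) :* ((ω :* ω :- ω :+ :1) :- :2 :* ((ω :- :1) :* (ω :- :1)))))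
           refl a r t ω i ⟩
    (two * a) * ((t * i) * (ω * ω - 1#)) + (1# + ω + ω * ω) * rest
      ≡⟨ cong₂ (λ b e → (two * a) * (b * (ω * ω - 1#)) + e * rest) ti≡1 e≡0 ⟩
    (two * a) * (1# * (ω * ω - 1#)) + 0# * rest
      ≡⟨ solve 3 (λ c d e → c :* (:1 :* d) :+ :0 :* e := c :* d) refl (two * a) (ω * ω - 1#) rest ⟩
    (two * a) * (ω * ω - 1#) ∎
    where rest = (two * a) * (r * i + t * i) + (i * i) * ((ω * ω - ω + 1#) - two * ((ω - 1#) * (ω - 1#)))

  -- Modulo 2 and 1 + ω + ω² the coefficients of a² and a vanish. In the rest ∑ iₖ³ cancels, leaving
  -- the cyclic sum of iₖ iₖ₊₁², which is (2ω⁴ + ω) i³ = ω i³.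
  cube-value : ∀ a r t ω i {r₂ r₃ i₂ i₃} → two ≡ 0# → 1# + ω + ω * ω ≡ 0# →
    r₂ ≡ r + t → r₃ ≡ r + t + ω * t → i₂ ≡ (ω * ω) * i → i₃ ≡ ω * i →
    (a ^ 3 * 0# + (a ^ 2 * ((0# + r * (0# + r * i)) + (0# + r₂ * (0# + r₂ * i₂)) + (0# + r₃ * (0# + r₃ * i₃))) +
                   a * ((i + r * i ^ 2) + (i₂ + r₂ * i₂ ^ 2) + (i₃ + r₃ * i₃ ^ 2)))) +
      ((i ^ 3 + i₂ ^ 3 + i₃ ^ 3) +
        ((i * (i * (i₂ - i) - i ^ 2) + i₂ * (i₂ * (i₃ - i₂) - i₂ ^ 2) + i₃ * (i₃ * (i - i₃) - i₃ ^ 2)) +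
         (i * (i₂ ^ 2 - i * (i₂ - i)) + i₂ * (i₃ ^ 2 - i₂ * (i₃ - i₂)) + i₃ * (i ^ 2 - i₃ * (i - i₃)))))
      ≡ ω * i ^ 3
  cube-value a r t ω i 2≡0 e≡0 refl refl refl refl = begin
    _ ≡⟨ solve 5 (λ a r t ω i →
           let r₂ = r :+ t
               r₃ = r :+ t :+ ω :* t
               i₂ = (ω :* ω) :* i
               i₃ = ω :* i
               :2 = :1 :+ :1
           in (a :^ 3 :* :0 :+ (a :^ 2 :* ((:0 :+ r :* (:0 :+ r :* i)) :+ (:0 :+ r₂ :* (:0 :+ r₂ :* i₂)) :+ (:0 :+ r₃ :* (:0 :+ r₃ :* i₃))) :+
                   a :* ((i :+ r :* i :^ 2) :+ (i₂ :+ r₂ :* i₂ :^ 2) :+ (i₃ :+ r₃ :* i₃ :^ 2)))) :+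
              ((i :^ 3 :+ i₂ :^ 3 :+ i₃ :^ 3) :+
                ((i :* (i :* (i₂ :- i) :- i :^ 2) :+ i₂ :* (i₂ :* (i₃ :- i₂) :- i₂ :^ 2) :+ i₃ :* (i₃ :* (i :- i₃) :- i₃ :^ 2)) :+
                 (i :* (i₂ :^ 2 :- i :* (i₂ :- i)) :+ i₂ :* (i₃ :^ 2 :- i₂ :* (i₃ :- i₂)) :+ i₃ :* (i :^ 2 :- i₃ :* (i :- i₃)))))
           := (ω :* i :^ 3 :+ (:1 :+ ω :+ ω :* ω) :*
                (a :^ 2 :* (r :^ 2 :* i :+ (t :^ 2 :* i) :* ω) :+ a :* (i :+ i :^ 2 :* (r :* (ω :^ 2 :- ω :+ :1) :+ t :* ω :^ 2)))) :+
              :2 :* (a :^ 2 :* ((r :* t :* i) :* (ω :+ ω :^ 2 :+ ω :^ 2) :+ t :^ 2 :* i :* ω :^ 2) :+ i :^ 3 :* ω :^ 4))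
           refl a r t ω i ⟩
    (ω * i ^ 3 + (1# + ω + ω * ω) * rest) + two * rest′   ≡⟨ two*-vanish _ 2≡0 ⟩
    ω * i ^ 3 + (1# + ω + ω * ω) * rest                   ≡⟨ cong (λ e → ω * i ^ 3 + e * rest) e≡0 ⟩
    ω * i ^ 3 + 0# * rest                                 ≡⟨ trans (cong (λ z → ω * i ^ 3 + z) (zeroˡ rest)) (+-identityʳ _) ⟩
    ω * i ^ 3                                             ∎
    where
    rest  = a ^ 2 * (r ^ 2 * i + (t ^ 2 * i) * ω) + a * (i + i ^ 2 * (r * (ω ^ 2 - ω + 1#) + t * ω ^ 2))
    rest′ = a ^ 2 * ((r * t * i) * (ω + ω ^ 2 + ω ^ 2) + t ^ 2 * i * ω ^ 2) + i ^ 3 * ω ^ 4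

-- Contradiction from the vanishing sums of f, f² and f³

module NotPermutation {N : ℕ} (L : FiniteField N) (m : ℕ) (4≤m : 4 ℕ.≤ m) (N≡q³ : N ≡ suc m ℕ.^ 3)
  (frobenius-+ : PowerAdditive (FiniteField.field′ L) (suc m))
  (a r : FiniteField.Carrier L) (r∉ : ¬ InFq L (suc m) r)
  (perm : IsPermutationP1 L (suc m) (fMap L (suc m) a r))
  where
  open FiniteField L
  open FieldProperties field′
  open FiniteFieldProperties L
  open Subfield L m (ℕ.≤-trans (s≤s z≤n) 4≤m) N≡q³ frobenius-+
  open Identities field′
  open ≡-Reasoning

  f : Carrier → Carrier
  f = fEval L q a r

  -- f sends ∞ to ∞, so the preimage of a finite point is finite.
  preimage : ∀ v → Fq v → ∃ λ x → Fq x × f x ≡ v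
  preimage v v∈ with proj₂ (proj₂ perm) (just v) v∈
  ... | just x , x∈ , fx≡v = x , x∈ , just-injective fx≡v

  f⁻¹ : Carrier → Carrier
  f⁻¹ v with Fq? v
  ... | yes v∈ = proj₁ (preimage v v∈)
  ... | no _   = v

  f⁻¹-Fq : ∀ v → Fq v → Fq (f⁻¹ v)
  f⁻¹-Fq v v∈ with Fq? v
  ... | yes v∈′ = proj₁ (proj₂ (preimage v v∈′))
  ... | no v∉   = ⊥-elim (v∉ v∈)

  f∘f⁻¹ : ∀ v → Fq v → f (f⁻¹ v) ≡ v
  f∘f⁻¹ v v∈ with Fq? v
  ... | yes v∈′ = proj₂ (proj₂ (preimage v v∈′))
  ... | no v∉   = ⊥-elim (v∉ v∈)

  f-Fq : ∀ x → Fq x → Fq (f x)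
  f-Fq x = proj₁ perm (just x)

  f⁻¹∘f : ∀ x → Fq x → f⁻¹ (f x) ≡ x
  f⁻¹∘f x x∈ = just-injective (proj₁ (proj₂ perm) _ _ (f⁻¹-Fq (f x) (f-Fq x x∈)) x∈ (cong just (f∘f⁻¹ (f x) (f-Fq x x∈))))

  ∑q-f^ : ∀ j → j ℕ.< m → ∑q (λ x → f x ^ j) ≡ 0#
  ∑q-f^ j j<m = trans (∑q-permute (_^ j) f f⁻¹ f-Fq f⁻¹-Fq f∘f⁻¹ f⁻¹∘f) (∑q-x^j j j<m)

  -- A function travels with its sum over F_q, so one linear combination yields both the right side
  -- of an expansion and the value to be compared with 0.
  record Summable : Set where
    constructor summable
    field
      fun    : Carrier → Carrier
      value  : Carrier
      ∑q-fun : ∑q fun ≡ value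
  open Summable

  infixl 6 _⊕_ _⊖_
  infixr 7 _⊙_

  _⊕_ : Summable → Summable → Summable
  g ⊕ h = summable (λ x → fun g x + fun h x) (value g + value h)
    (trans (∑q-+ (fun g) (fun h)) (cong₂ _+_ (∑q-fun g) (∑q-fun h)))

  _⊙_ : Carrier → Summable → Summable
  c ⊙ g = summable (λ x → c * fun g x) (c * value g) (trans (∑q-* c (fun g)) (cong (c *_) (∑q-fun g)))

  _⊖_ : Summable → Summable → Summable
  g ⊖ h = summable (λ x → fun g x - fun h x) (value g - value h) (begin
    ∑q (λ x → fun g x - fun h x)            ≡⟨ ∑q-cong (λ x _ → minus (fun g x) (fun h x)) ⟩
    ∑q (λ x → fun g x + - 1# * fun h x)     ≡⟨ ∑q-fun (g ⊕ (- 1#) ⊙ h) ⟩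
    value g + - 1# * value h                ≡⟨ sym (minus (value g) (value h)) ⟩
    value g - value h                       ∎)
    where
    minus : ∀ x y → x - y ≡ x + - 1# * y
    minus = solve 2 (λ x y → x :- y := x :+ :- :1 :* y) refl

  X^ : ∀ j → j ℕ.< 4 → Summable
  X^ j j<4 = summable (λ x → x ^ j) 0# (∑q-x^j j (ℕ.<-≤-trans j<4 4≤m))

  -- `X` is separate from `X^ 1` because `x ^ 1` unfolds to `x * 1#`, while the expansions contain x
  -- itself.
  𝟏 X : Summable
  𝟏 = X^ 0 (s≤s z≤n)
  X = summable (λ x → x) 0# (trans (∑q-cong (λ x _ → sym (*-identityʳ x))) (∑q-fun (X^ 1 (s≤s (s≤s z≤n)))))

  r₂ r₃ : Carrier
  r₂ = r ^ q
  r₃ = r ^ (q ℕ.* q)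

  r₂^q≡r₃ : r₂ ^ q ≡ r₃
  r₂^q≡r₃ = ^-* r q q

  r₃^q≡r : r₃ ^ q ≡ r
  r₃^q≡r = trans (cong (_^ q) (sym r₂^q≡r₃)) (frobenius³ r)

  -- If the Frobenius map fixes r₂, then r₂ = (r₂^q)^q = r^(q³) = r.
  r₂∉ : ¬ Fq r₂
  r₂∉ r₂∈ = r∉ (begin
    r ^ q               ≡⟨ sym r₂∈ ⟩
    r₂ ^ q              ≡⟨ cong (_^ q) (sym r₂∈) ⟩
    (r₂ ^ q) ^ q        ≡⟨ frobenius³ r ⟩
    r                   ∎)

  r₃∉ : ¬ Fq r₃
  r₃∉ r₃∈ = r₂∉ (begin
    r₂ ^ q              ≡⟨ r₂^q≡r₃ ⟩
    r₃                  ≡⟨ sym r₃∈ ⟩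
    r₃ ^ q              ≡⟨ r₃^q≡r ⟩
    r                   ≡⟨ sym r₃^q≡r ⟩
    r₃ ^ q              ≡⟨ cong (_^ q) (sym r₃∈) ⟩
    (r₃ ^ q) ^ q        ≡⟨ cong (_^ q) r₃^q≡r ⟩
    r₂                  ∎)

  module C₁ = Carlitz r∉
  module C₂ = Carlitz r₂∉
  module C₃ = Carlitz r₃∉

  module Powers {s} (s∉ : ¬ Fq s) where
    open Carlitz s∉
    i : Carrier
    i = t ⁻¹
    -- Writing x = (x - s) + s removes every factor x in front of a fraction: x y = 1 + s y, and the
    -- other two products follow from it.
    Y Y² Y³ XY X²Y XY² : Summable
    Y   = summable y i (trans (∑q-cong (λ x _ → sym (*-identityʳ (y x)))) (trans (∑q-y^ 0 z≤n) (*-identityʳ i)))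
    Y²  = summable (λ x → y x ^ 2) (i ^ 2) (∑q-y^ 1 (ℕ.≤-trans (s≤s z≤n) 4≤m))
    Y³  = summable (λ x → y x ^ 3) (i ^ 3) (∑q-y^ 2 (ℕ.≤-trans (s≤s (s≤s z≤n)) 4≤m))
    XY  = 𝟏 ⊕ s ⊙ Y
    X²Y = X ⊕ s ⊙ XY
    XY² = Y ⊕ s ⊙ Y²

    y⁻¹ : ∀ {x} → Fq x → (x - s) * y x ≡ 1#
    y⁻¹ x∈ = inverseʳ _ (x-r≢0 x∈)

    xy : ∀ {x} → Fq x → x * y x ≡ fun XY x
    xy x∈ = x*y≡1+r*y (y⁻¹ x∈)

    x²y : ∀ {x} → Fq x → x * (x * y x) ≡ fun X²Y x
    x²y {x} x∈ = begin
      x * (x * y x)                  ≡⟨ cong (x *_) (xy x∈) ⟩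
      x * (1# + s * y x)             ≡⟨ solve 3 (λ x s y → x :* (:1 :+ s :* y) := x :+ s :* (x :* y)) refl x s (y x) ⟩
      x + s * (x * y x)              ≡⟨ cong (λ z → x + s * z) (xy x∈) ⟩
      x + s * (1# + s * y x)         ∎

    xy² : ∀ {x} → Fq x → (x * y x) * y x ≡ fun XY² x
    xy² {x} x∈ = trans (cong (_* y x) (xy x∈)) (solve 2 (λ s y → (:1 :+ s :* y) :* y := y :+ s :* y :^ 2) refl s (y x))

  open Powers r∉ renaming (i to i₁; Y to Y₁; Y² to Y₁²; Y³ to Y₁³; XY to XY₁; X²Y to X²Y₁; XY² to XY₁²; y⁻¹ to y₁⁻¹; xy to xy₁; x²y to x²y₁; xy² to xy₁²)
  open Powers r₂∉ renaming (i to i₂; Y to Y₂; Y² to Y₂²; Y³ to Y₂³; XY to XY₂; X²Y to X²Y₂; XY² to XY₂²; y⁻¹ to y₂⁻¹; xy to xy₂; x²y to x²y₂; xy² to xy₂²)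
  open Powers r₃∉ renaming (i to i₃; Y to Y₃; Y² to Y₃²; Y³ to Y₃³; XY to XY₃; X²Y to X²Y₃; XY² to XY₃²; y⁻¹ to y₃⁻¹; xy to xy₃; x²y to x²y₃; xy² to xy₃²)

  -- `C₂.t` and `C₃.t` involve r₂^q and r₃^q. Written with r₃ and r instead, the differences
  -- telescope and have the shape that `partial-fraction` expects.
  t₁ t₂ t₃ : Carrier
  t₁ = r₂ - r
  t₂ = r₃ - r₂
  t₃ = r - r₃

  t₁*i₁≡1 : t₁ * i₁ ≡ 1#
  t₁*i₁≡1 = inverseʳ _ C₁.t≢0

  t₂*i₂≡1 : t₂ * i₂ ≡ 1#
  t₂*i₂≡1 = subst (λ z → (z - r₂) * i₂ ≡ 1#) r₂^q≡r₃ (inverseʳ _ C₂.t≢0)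

  t₃*i₃≡1 : t₃ * i₃ ≡ 1#
  t₃*i₃≡1 = subst (λ z → (z - r₃) * i₃ ≡ 1#) r₃^q≡r (inverseʳ _ C₃.t≢0)

  f≡fun⇒value≡0 : ∀ j → j ℕ.< m → (g : Summable) → (∀ x → Fq x → f x ^ j ≡ fun g x) → value g ≡ 0#
  f≡fun⇒value≡0 j j<m g f≡g = trans (sym (∑q-fun g)) (trans (sym (∑q-cong f≡g)) (∑q-f^ j j<m))

  ∑i≡0 : i₁ + i₂ + i₃ ≡ 0#
  ∑i≡0 = begin
    i₁ + i₂ + i₃                ≡⟨ solve 4 (λ a i₁ i₂ i₃ → i₁ :+ i₂ :+ i₃ := a :* :0 :+ i₁ :+ i₂ :+ i₃) refl a i₁ i₂ i₃ ⟩
    a * 0# + i₁ + i₂ + i₃       ≡⟨ f≡fun⇒value≡0 1 (ℕ.≤-trans (s≤s (s≤s z≤n)) 4≤m) (a ⊙ X ⊕ Y₁ ⊕ Y₂ ⊕ Y₃) (λ x _ → *-identityʳ _) ⟩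
    0#                          ∎

  ∑t≡0 : t₁ + t₂ + t₃ ≡ 0#
  ∑t≡0 = solve 3 (λ r r₂ r₃ → (r₂ :- r) :+ (r₃ :- r₂) :+ (r :- r₃) := :0) refl r r₂ r₃

  open CubeRoot t₁*i₁≡1 t₂*i₂≡1 t₃*i₃≡1 ∑t≡0 ∑i≡0

  r₂≡ : r₂ ≡ r + t₁
  r₂≡ = solve 2 (λ r r₂ → r₂ := r :+ (r₂ :- r)) refl r r₂

  r₃≡ : r₃ ≡ r + t₁ + ω * t₁
  r₃≡ = trans (solve 3 (λ r r₂ r₃ → r₃ := r :+ (r₂ :- r) :+ (r₃ :- r₂)) refl r r₂ r₃) (cong (λ z → r + t₁ + z) t₂≡ω*t₁)

  Y₁Y₂ Y₂Y₃ Y₃Y₁ : Summable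
  Y₁Y₂ = i₁ ⊙ (Y₂ ⊖ Y₁)
  Y₂Y₃ = i₂ ⊙ (Y₃ ⊖ Y₂)
  Y₃Y₁ = i₃ ⊙ (Y₁ ⊖ Y₃)

  module _ {x} (x∈ : Fq x) where
    y₁y₂ : C₁.y x * C₂.y x ≡ fun Y₁Y₂ x
    y₁y₂ = partial-fraction (y₁⁻¹ x∈) (y₂⁻¹ x∈) t₁*i₁≡1
    y₂y₃ : C₂.y x * C₃.y x ≡ fun Y₂Y₃ x
    y₂y₃ = partial-fraction (y₂⁻¹ x∈) (y₃⁻¹ x∈) t₂*i₂≡1
    y₃y₁ : C₃.y x * C₁.y x ≡ fun Y₃Y₁ x
    y₃y₁ = partial-fraction (y₃⁻¹ x∈) (y₁⁻¹ x∈) t₃*i₃≡1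

  2a[ω²-1]≡0 : (two * a) * (ω * ω - 1#) ≡ 0#
  2a[ω²-1]≡0 = trans (sym (square-value a r t₁ ω i₁ t₁*i₁≡1 1+ω+ω²≡0 r₂≡ r₃≡ i₂≡ω²*i₁ i₃≡ω*i₁))
    (f≡fun⇒value≡0 2 (ℕ.≤-trans (s≤s (s≤s (s≤s z≤n))) 4≤m)
      (((a ^ 2) ⊙ X^ 2 (s≤s (s≤s (s≤s z≤n))) ⊕ (two * a) ⊙ (XY₁ ⊕ XY₂ ⊕ XY₃)) ⊕ ((Y₁² ⊕ Y₂² ⊕ Y₃²) ⊕ two ⊙ (Y₁Y₂ ⊕ Y₂Y₃ ⊕ Y₃Y₁)))
      (λ x x∈ → square-expansion a x _ _ _ (xy₁ x∈) (xy₂ x∈) (xy₃ x∈) (y₁y₂ x∈) (y₂y₃ x∈) (y₃y₁ x∈)))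

  ω*i³≡0 : two ≡ 0# → ω * i₁ ^ 3 ≡ 0#
  ω*i³≡0 2≡0 = trans (sym (cube-value a r t₁ ω i₁ 2≡0 1+ω+ω²≡0 r₂≡ r₃≡ i₂≡ω²*i₁ i₃≡ω*i₁))
    (f≡fun⇒value≡0 3 4≤m
      (((a ^ 3) ⊙ X^ 3 (s≤s (s≤s (s≤s (s≤s z≤n)))) ⊕ ((a ^ 2) ⊙ (X²Y₁ ⊕ X²Y₂ ⊕ X²Y₃) ⊕ a ⊙ (XY₁² ⊕ XY₂² ⊕ XY₃²))) ⊕
       ((Y₁³ ⊕ Y₂³ ⊕ Y₃³) ⊕
         ((i₁ ⊙ (Y₁Y₂ ⊖ Y₁²) ⊕ i₂ ⊙ (Y₂Y₃ ⊖ Y₂²) ⊕ i₃ ⊙ (Y₃Y₁ ⊖ Y₃²)) ⊕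
          (i₁ ⊙ (Y₂² ⊖ Y₁Y₂) ⊕ i₂ ⊙ (Y₃² ⊖ Y₂Y₃) ⊕ i₃ ⊙ (Y₁² ⊖ Y₃Y₁)))))
      (λ x x∈ → cube-expansion a x _ _ _ 2≡0 (x²y₁ x∈) (x²y₂ x∈) (x²y₃ x∈) (xy₁² x∈) (xy₂² x∈) (xy₃² x∈)
        (partial-fraction-y (y₁y₂ x∈)) (partial-fraction-y (y₂y₃ x∈)) (partial-fraction-y (y₃y₁ x∈))
        (partial-fraction-z (y₁y₂ x∈)) (partial-fraction-z (y₂y₃ x∈)) (partial-fraction-z (y₃y₁ x∈))))

  impossible : 1# + 1# + 1# ≢ 0# → a ≢ 0# → ⊥
  impossible 3≢0 a≢0 with ∑._≟_ two 0#
  ... | yes 2≡0 = *-≢0 ω≢0 (^-≢0 3 (⁻¹-≢0 C₁.t≢0)) (ω*i³≡0 2≡0)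
  ... | no 2≢0  = *-≢0 (*-≢0 2≢0 a≢0) (ω²-1≢0 3≢0) 2a[ω²-1]≡0

-- Passage from a prime power q to the Frobenius hypothesis

open import Data.Nat using (_^_)

theorem4p4 : (q : ℕ) → IsPrimePower q → q ≥ 5 →
    (L : FiniteField (q ^ 3)) →
    ¬ (FiniteField._+_ L (FiniteField._+_ L (FiniteField.1# L) (FiniteField.1# L)) (FiniteField.1# L) ≡ FiniteField.0# L) →
    (a r : FiniteField.Carrier L) →
    InFq L q a → ¬ (a ≡ FiniteField.0# L) →
    ¬ InFq L q r →
    ¬ IsPermutationP1 L q (fMap L q a r)
theorem4p4 (suc m) (p , k , pp , _ , q≡p^k) (s≤s 4≤m) L 3≢0 a r _ a≢0 r∉ perm =
  NotPermutation.impossible L m 4≤m refl frobenius-+ a r r∉ perm 3≢0 a≢0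
  where
  open FiniteField L using (field′)
  -- That p · 1 = 0 in L is deduced from the size of L, which must first be seen as a power of p.
  q³≡p^[k*3] : suc m ^ 3 ≡ p ^ (k ℕ.* 3)
  q³≡p^[k*3] = trans (cong (_^ 3) q≡p^k) (ℕ.^-*-assoc p k 3)
  frobenius-+ : PowerAdditive field′ (suc m)
  frobenius-+ = subst (PowerAdditive field′) (sym q≡p^k)
    (Frobenius.^p^k-homo-+ field′ pp (FiniteFieldProperties.p×1≡0 L p (k ℕ.* 3) q³≡p^[k*3]) k)
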